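{- Let $n,\alpha\in\mathbb{Z}_{\ge 1}$ be such that $3n\equiv 1\pmod{4^{\alpha}}$. Then $d_7(n)\equiv 0\pmod{8^{\alpha}}$.
   Context: For an integer $k\ge 0$, the integers $d_k(n)$, $n\ge 0$ (the number of $k$-elongated plane partition diamonds) are given by the generating function $$\sum_{n=0}^{\infty}d_k(n)q^n = \prod_{m=1}^{\infty}\frac{(1-q^{2m})^k}{(1-q^m)^{3k+1}}.$$ In particular $\sum_{n\ge 0} d_7(n)q^n=\prod_{m\ge 1}(1-q^{2m})^7(1-q^m)^{ -22}$. -}

module Defs where

open import Data.Bool.Base using (if_then_else_)
open import Data.Fin.Base as Fin using (Fin; toℕ)
open import Data.Fin.Properties using (toℕ≤pred[n])
open import Data.Integer.Base using (ℤ; 0ℤ; 1ℤ; -1ℤ; _+_; _-_; -_; _*_)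
open import Data.Integer.Divisibility.Signed using (_∣_)
import Data.Integer.Properties as ℤ
open import Data.Nat.Base as ℕ using (ℕ; zero; suc; _∸_; _≤_; _<_; z≤n; s≤s; _≡ᵇ_)
import Data.Nat.Divisibility as ℕ
import Data.Nat.Properties as ℕ
open import Function.Base using (_∘_)
open import Relation.Binary.PropositionalEquality
open import Relation.Nullary.Decidable using (does; yes; no; dec-true; dec-false)

open import Algebra.Properties.Semiring.Sum ℤ.+-*-semiring
  using (sum⁺-syntax; sum; sum-cong-≗; sum-replicate-zero)

infix 4 _≡_[mod_]

_≡_[mod_] : ℤ → ℤ → ℤ → Set
a ≡ b [mod m ] = m ∣ a - b

-- Formal power series over ℤ in q; f n is the coefficient of qⁿ.

PowerSeries : Set
PowerSeries = ℕ → ℤ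

infixl 7 _⊛_
infixr 8 _^ₛ_

q^_ : ℕ → PowerSeries
(q^ m) i = if i ≡ᵇ m then 1ℤ else 0ℤ

1ₛ : PowerSeries
1ₛ = q^ 0

1-q^_ : ℕ → PowerSeries
(1-q^ m) i = 1ₛ i - (q^ m) i

_⊛_ : PowerSeries → PowerSeries → PowerSeries
(f ⊛ g) n = ∑[ i ≤ n ] (f (toℕ i) * g (n ∸ toℕ i))

_^ₛ_ : PowerSeries → ℕ → PowerSeries
f ^ₛ zero  = 1ₛ
f ^ₛ suc k = f ⊛ f ^ₛ k

-- The geometric series Σ_j q^{mj}; it is (1 - q^m)⁻¹ when m ≥ 1, as
-- 1-q^-inverse below shows.

1/1-q^_ : ℕ → PowerSeries
(1/1-q^ m) i = if does (m ℕ.∣? i) then 1ℤ else 0ℤ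

∏[1⋯_] : ℕ → (ℕ → PowerSeries) → PowerSeries
∏[1⋯ zero  ] F = 1ₛ
∏[1⋯ suc N ] F = F (suc N) ⊛ ∏[1⋯ N ] F

factor : ℕ → ℕ → PowerSeries
factor k m = (1-q^ (2 ℕ.* m)) ^ₛ k ⊛ (1/1-q^ m) ^ₛ (3 ℕ.* k ℕ.+ 1)

-- The infinite product is read coefficientwise. Its m-th factor is
-- 1 + O(q^m), so the coefficient of qⁿ is already attained by the product
-- over 1 ≤ m ≤ n; d-generating-function below proves this.

d : ℕ → ℕ → ℤ
d k n = (∏[1⋯ n ] (factor k)) n

private
  sum-zero : ∀ {n} (t : Fin n → ℤ) → (∀ i → t i ≡ 0ℤ) → sum t ≡ 0ℤ
  sum-zero {n} t t≡0 = trans (sum-cong-≗ t≡0) (sum-replicate-zero n)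

  term : ℕ → (ℕ → ℤ) → ℕ → ℤ
  term m h j = (0ℤ - (q^ m) j) * h j

  pick : ∀ n m (h : ℕ → ℤ) → m < n →
         sum {n} (term m h ∘ toℕ) ≡ - h m
  pick (suc n) zero h _ = begin
    -1ℤ * h 0 + sum {n} (term 0 h ∘ toℕ ∘ Fin.suc)
      ≡⟨ cong₂ _+_ (ℤ.-1*i≡-i (h 0)) (sum-zero {n} _ λ j → ℤ.*-zeroˡ (h (suc (toℕ j)))) ⟩
    - h 0 + 0ℤ
      ≡⟨ ℤ.+-identityʳ _ ⟩
    - h 0 ∎
    where open ≡-Reasoning
  pick (suc n) (suc m) h (s≤s m<n) =
    trans (cong₂ _+_ (ℤ.*-zeroˡ (h 0)) (pick n m (h ∘ suc) m<n)) (ℤ.+-identityˡ _)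

  pick-none : ∀ n m (h : ℕ → ℤ) → n ≤ m →
              sum {n} (term m h ∘ toℕ) ≡ 0ℤ
  pick-none zero    m       h _         = refl
  pick-none (suc n) (suc m) h (s≤s n≤m) =
    cong₂ _+_ (ℤ.*-zeroˡ (h 0)) (pick-none n m (h ∘ suc) n≤m)

  geometric-shift : ∀ m i → m ≤ i → (1/1-q^ suc m) (suc i) ≡ (1/1-q^ suc m) (i ∸ m)
  geometric-shift m i m≤i with suc m ℕ.∣? (i ∸ m)
  ... | yes p = cong (if_then 1ℤ else 0ℤ) (trans
          (dec-true (suc m ℕ.∣? suc i) (ℕ.∣m∸n∣n⇒∣m (suc m) (s≤s m≤i) p ℕ.∣-refl))
          (sym (dec-true (suc m ℕ.∣? (i ∸ m)) p)))
  ... | no ¬p = cong (if_then 1ℤ else 0ℤ) (trans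
          (dec-false (suc m ℕ.∣? suc i) λ p → ¬p (ℕ.∣m+n∣m⇒∣n
            (subst (suc m ℕ.∣_) (cong suc (sym (ℕ.m+[n∸m]≡n m≤i))) p) ℕ.∣-refl))
          (sym (dec-false (suc m ℕ.∣? (i ∸ m)) ¬p)))

1-q^-inverse : ∀ m .{{_ : ℕ.NonZero m}} n → ((1-q^ m) ⊛ (1/1-q^ m)) n ≡ 1ₛ n
1-q^-inverse (suc m) zero =
  cong (λ b → 1ℤ * (if b then 1ℤ else 0ℤ) + 0ℤ)
       (dec-true (suc m ℕ.∣? 0) (suc m ℕ.∣0))
1-q^-inverse (suc m) (suc n) with m ℕ.≤? n
... | yes m≤n = begin
  1ℤ * g (suc n) + sum {suc n} (term m (λ j → g (n ∸ j)) ∘ toℕ)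
    ≡⟨ cong₂ _+_ (ℤ.*-identityˡ (g (suc n))) (pick (suc n) m (λ j → g (n ∸ j)) (s≤s m≤n)) ⟩
  g (suc n) - g (n ∸ m)
    ≡⟨ ℤ.i≡j⇒i-j≡0 (geometric-shift m n m≤n) ⟩
  0ℤ ∎
  where
  open ≡-Reasoning
  g = 1/1-q^ suc m
... | no m≰n = begin
  1ℤ * g (suc n) + sum {suc n} (term m (λ j → g (n ∸ j)) ∘ toℕ)
    ≡⟨ cong₂ _+_ (ℤ.*-identityˡ (g (suc n))) (pick-none (suc n) m (λ j → g (n ∸ j)) n<m) ⟩
  g (suc n) + 0ℤ
    ≡⟨ ℤ.+-identityʳ _ ⟩
  g (suc n)
    ≡⟨ cong (if_then 1ℤ else 0ℤ) (dec-false (suc m ℕ.∣? suc n) (ℕ.>⇒∤ (s≤s n<m))) ⟩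
  0ℤ ∎
  where
  open ≡-Reasoning
  g = 1/1-q^ suc m
  n<m = ℕ.≰⇒> m≰n

private
  _≈[_]_ : PowerSeries → ℕ → PowerSeries → Set
  f ≈[ n ] g = ∀ i → i ≤ n → f i ≡ g i

  ⊛-cong : ∀ {n f f′ g g′} → f ≈[ n ] f′ → g ≈[ n ] g′ → (f ⊛ g) ≈[ n ] (f′ ⊛ g′)
  ⊛-cong p q i i≤n = sum-cong-≗ {suc i} λ j → cong₂ _*_
    (p (toℕ j) (ℕ.≤-trans (toℕ≤pred[n] j) i≤n))
    (q (i ∸ toℕ j) (ℕ.≤-trans (ℕ.m∸n≤m i (toℕ j)) i≤n))

  ⊛-identityˡ : ∀ f n → (1ₛ ⊛ f) n ≡ f n
  ⊛-identityˡ f n = trans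
    (cong₂ _+_ (ℤ.*-identityˡ (f n)) (sum-zero {n} _ λ j → ℤ.*-zeroˡ (f (n ∸ suc (toℕ j)))))
    (ℤ.+-identityʳ (f n))

  ⊛-one : ∀ {n f g h} → f ≈[ n ] 1ₛ → g ≈[ n ] h → (f ⊛ g) ≈[ n ] h
  ⊛-one {h = h} p q i i≤n = trans (⊛-cong p q i i≤n) (⊛-identityˡ h i)

  ^ₛ-one : ∀ {n f} k → f ≈[ n ] 1ₛ → (f ^ₛ k) ≈[ n ] 1ₛ
  ^ₛ-one zero    p i i≤n = refl
  ^ₛ-one (suc k) p = ⊛-one p (^ₛ-one k p)

  q^-zero : ∀ {n m} → n < m → ∀ i → i ≤ n → (q^ m) i ≡ 0ℤ
  q^-zero (s≤s _)         zero    _         = refl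
  q^-zero (s≤s (s≤s n<m)) (suc i) (s≤s i≤n) = q^-zero (s≤s n<m) i i≤n

  1-q^-one : ∀ {n m} → n < m → (1-q^ m) ≈[ n ] 1ₛ
  1-q^-one n<m i i≤n =
    trans (cong (λ x → 1ₛ i - x) (q^-zero n<m i i≤n)) (ℤ.+-identityʳ (1ₛ i))

  1/1-q^-one : ∀ {n m} → n < m → (1/1-q^ m) ≈[ n ] 1ₛ
  1/1-q^-one {m = m} n<m zero    _   =
    cong (if_then 1ℤ else 0ℤ) (dec-true (m ℕ.∣? 0) (m ℕ.∣0))
  1/1-q^-one {m = m} n<m (suc i) i≤n =
    cong (if_then 1ℤ else 0ℤ) (dec-false (m ℕ.∣? suc i) (ℕ.>⇒∤ (ℕ.≤-<-trans i≤n n<m)))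

  factor-one : ∀ k {n m} → n < m → factor k m ≈[ n ] 1ₛ
  factor-one k {m = m} n<m = ⊛-one
    (^ₛ-one k (1-q^-one (ℕ.<-≤-trans n<m (ℕ.m≤m+n m _))))
    (^ₛ-one (3 ℕ.* k ℕ.+ 1) (1/1-q^-one n<m))

d-generating-function : ∀ k {n N} → n ≤ N → (∏[1⋯ N ] (factor k)) n ≡ d k n
d-generating-function k n≤N = go (ℕ.≤⇒≤′ n≤N)
  where
  go : ∀ {n N} → n ℕ.≤′ N → (∏[1⋯ N ] (factor k)) n ≡ d k n
  go (ℕ.≤′-reflexive refl) = refl
  go {n} {suc N} (ℕ.≤′-step p) = trans
    (⊛-one {n} {g = P} {h = P} (factor-one k (s≤s (ℕ.≤′⇒≤ p))) (λ _ _ → refl) n ℕ.≤-refl)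
    (go p)
    where P = ∏[1⋯ N ] (factor k)

{-# OPTIONS --safe #-}
module Submission where

-- Write φ = φ(q), ψ = ψ(q) for Gauss's theta functions, E_r = ∏(1 − q^(rm)),
-- and put A = ψ(q²)/φ(q), w = q A(q⁴), W = q A⁴, so that w⁴ = W(q⁴). With v = 2w,
--
--   (1 ± v) φ(q⁴) = φ(±q),     2W = e(v) where e(x) = x(1 + x²)/(1 + x)⁴,
--
-- and for Z = 1/(φ¹¹ E₂⁴) one has Σ d₇(n)qⁿ = Z ((1 + v)/(1 − v))¹¹ and
-- qZ = Z(q⁴) w k(v) where k(x) = 1/((1 − x)(1 + x)¹²).
-- Let U keep the coefficients of index divisible by 4. Since w⁴ is a series in q⁴
-- and w¹, w², w³ have only exponents 1, 2, 3 mod 4,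
--
--   U(q Z h(v)) = Z U(w (kh)(v)) = Z (8 (kh)₃ W + 32 r(v))   for some r ∈ ℤ⟦x⟧.
--
-- As (ke)₃ = 122 is even, f ↦ U(qf) sends Z · {a · 2W + 4 g(v)} into 8 times itself;
-- Σ d₇(n)qⁿ enters 4 times this set after one step, and 2W and 4 are even.
-- Finally 3n ≡ 1 (mod 4^α) makes d₇(n) a coefficient of the α-th iterate.

open import Defs
open import Data.Nat.Base using (ℕ; _≥_; _^_)
open import Data.Integer.Base using (+_; _*_)

open import Algebra.Bundles using (CommutativeRing)
import Algebra.Properties.CommutativeSemiring.Exp
import Algebra.Solver.Ring
open import Algebra.Solver.Ring.AlmostCommutativeRing
  using (fromCommutativeRing; _-Raw-AlmostCommutative⟶_)
open import Data.Fin.Base as Fin using (toℕ)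
open import Data.Integer.Base as ℤ using (ℤ; 0ℤ; 1ℤ)
open import Data.Integer.Divisibility.Signed
  using (_∣_; divides; _∣?_; *-cancelˡ-∣; ∣-trans; ∣m⇒∣m*n; ∣-refl; ∣m∣n⇒∣m-n)
import Data.Integer.Properties as ℤ
import Data.Integer.Tactic.RingSolver as ℤSolver
open import Data.Maybe.Base using (Maybe; nothing; just)
open import Data.Nat.Base as ℕ using (zero; suc; _≤_; _<_; z≤n; s≤s)
open import Data.Nat.DivMod using (_divMod_; result)
import Data.Nat.Properties as ℕ
import Data.Nat.Tactic.RingSolver as ℕSolver
open import Data.Product.Base using (_,_; ∃; ∃₂; map₂; proj₁; proj₂)
open import Level using (0ℓ)
open import Relation.Binary.Bundles using (Setoid)
open import Relation.Binary.PropositionalEquality as ≡ using (_≡_; cong; cong₂)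
import Relation.Binary.Reasoning.Setoid as SetoidReasoning
open import Relation.Binary.Structures using (IsEquivalence)
open import Relation.Nullary.Decidable using (yes; no; from-no)
open import Relation.Nullary.Negation using (contradiction)

-- The ring of formal power series

-- The obstacle is a factor 2. One application of U yields 8(kh)₃W, but the next one needs a series
-- in v, and it is 2W that is one: W(1 + v)⁴ = w(1 + v²) has w, that is v/2, on the right. Rewriting
-- 8W as 4·2W loses a factor 2 at every step, and the parity of (ke)₃ restores it; hence the
-- two-term shape, in which the multiple of 2W = e(v) is tracked exactly and everything else only
-- modulo 4. The remainder is harmless: it comes from w⁸ and higher powers and is 128W² = 32(2W)²
-- times a series in 2W. As E₂ is even in q, Z is the series of d₇ at -q. The sign is changed
-- because U compares a series with its own value at q⁴, and both φ(q) and φ(-q) are 1 ± v times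
-- φ(q⁴), which is what φ(q) itself becomes at q⁴.

infix 4 _≈_ _≈[_]_
infixl 6 _⊞_
infixl 7 _∙_

-- A record rather than a bare function type, so that both series can be recovered from the type of
-- a proof.
record _≈_ (f g : PowerSeries) : Set where
  constructor mk
  field at : ∀ n → f n ≡ g n
open _≈_

-- Congruence modulo q^N. The strict bound makes N = 0 vacuous, which is the base case of the
-- inductions on precision.
record _≈[_]_ (f : PowerSeries) (N : ℕ) (g : PowerSeries) : Set where
  constructor mk
  field below : ∀ {n} → n < N → f n ≡ g n
open _≈[_]_

const : ℤ → PowerSeries
const c zero    = c
const c (suc n) = 0ℤ

tail : PowerSeries → PowerSeries
tail f n = f (suc n)

opaque
  _⊞_ : PowerSeries → PowerSeries → PowerSeries
  (f ⊞ g) n = f n ℤ.+ g n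

  ⊟_ : PowerSeries → PowerSeries
  (⊟ f) n = ℤ.- f n

  -- Opaque, so that symbolic convolutions stay folded: products are handled through `∙-zero` and
  -- `∙-suc` and are evaluated only in `ke₃`.
  _∙_ : PowerSeries → PowerSeries → PowerSeries
  _∙_ = _⊛_

opaque
  unfolding _∙_

  ⊞-at : ∀ f g n → (f ⊞ g) n ≡ f n ℤ.+ g n
  ⊞-at f g n = ≡.refl

  ⊟-at : ∀ f n → (⊟ f) n ≡ ℤ.- f n
  ⊟-at f n = ≡.refl

  ∙-zero : ∀ f g → (f ∙ g) 0 ≡ f 0 ℤ.* g 0
  ∙-zero f g = ℤ.+-identityʳ _

  ∙-suc : ∀ f g n → (f ∙ g) (suc n) ≡ f 0 ℤ.* g (suc n) ℤ.+ (tail f ∙ g) n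
  ∙-suc f g n = ≡.refl

  ⊛≈∙ : ∀ f g → f ⊛ g ≈ f ∙ g
  ⊛≈∙ f g = mk λ n → ≡.refl

-- The convolution peeled at its other end; matched against `∙-suc`, it turns commutativity into an
-- induction.
∙-sucʳ : ∀ f g n → (f ∙ g) (suc n) ≡ (f ∙ tail g) n ℤ.+ f (suc n) ℤ.* g 0
∙-sucʳ f g zero = ≡.trans (∙-suc f g 0)
  (cong₂ ℤ._+_ (≡.sym (∙-zero f (tail g))) (∙-zero (tail f) g))
∙-sucʳ f g (suc n) = begin
  (f ∙ g) (suc (suc n))
    ≡⟨ ∙-suc f g (suc n) ⟩
  f 0 ℤ.* g (suc (suc n)) ℤ.+ (tail f ∙ g) (suc n)
    ≡⟨ cong (λ z → f 0 ℤ.* g (suc (suc n)) ℤ.+ z) (∙-sucʳ (tail f) g n) ⟩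
  f 0 ℤ.* g (suc (suc n)) ℤ.+ ((tail f ∙ tail g) n ℤ.+ f (suc (suc n)) ℤ.* g 0)
    ≡⟨ ≡.sym (ℤ.+-assoc (f 0 ℤ.* g (suc (suc n))) _ _) ⟩
  f 0 ℤ.* g (suc (suc n)) ℤ.+ (tail f ∙ tail g) n ℤ.+ f (suc (suc n)) ℤ.* g 0
    ≡⟨ cong (ℤ._+ f (suc (suc n)) ℤ.* g 0) (∙-suc f (tail g) n) ⟨
  (f ∙ tail g) (suc n) ℤ.+ f (suc (suc n)) ℤ.* g 0 ∎
  where open ≡.≡-Reasoning

∙-below : ∀ {N f f′ g g′} → f ≈[ N ] f′ → g ≈[ N ] g′ → f ∙ g ≈[ N ] f′ ∙ g′
∙-below p q = mk (go p q)
  where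
  go : ∀ {N f f′ g g′} → f ≈[ N ] f′ → g ≈[ N ] g′ → ∀ {n} → n < N → (f ∙ g) n ≡ (f′ ∙ g′) n
  go {f = f} {f′} {g} {g′} p q {zero} 0<N = begin
    (f ∙ g) 0       ≡⟨ ∙-zero f g ⟩
    f 0 ℤ.* g 0     ≡⟨ cong₂ ℤ._*_ (below p 0<N) (below q 0<N) ⟩
    f′ 0 ℤ.* g′ 0   ≡⟨ ∙-zero f′ g′ ⟨
    (f′ ∙ g′) 0     ∎
    where open ≡.≡-Reasoning
  go {suc N} {f} {f′} {g} {g′} p q {suc n} (s≤s n<N) = begin
    (f ∙ g) (suc n)
      ≡⟨ ∙-suc f g n ⟩
    f 0 ℤ.* g (suc n) ℤ.+ (tail f ∙ g) n
      ≡⟨ cong₂ ℤ._+_ (cong₂ ℤ._*_ (below p (s≤s z≤n)) (below q (s≤s n<N)))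
           (go {N} {tail f} {tail f′} {g} {g′} (mk λ i<N → below p (s≤s i<N))
             (mk λ i<N → below q (ℕ.m<n⇒m<1+n i<N)) n<N) ⟩
    f′ 0 ℤ.* g′ (suc n) ℤ.+ (tail f′ ∙ g′) n
      ≡⟨ ∙-suc f′ g′ n ⟨
    (f′ ∙ g′) (suc n) ∎
    where open ≡.≡-Reasoning

truncate : ∀ {N f g} → f ≈ g → f ≈[ N ] g
truncate p = mk λ {n} _ → at p n

limit : ∀ {f g} → (∀ N → f ≈[ N ] g) → f ≈ g
limit p = mk λ n → below (p (suc n)) ℕ.≤-refl

∙-cong : ∀ {f f′ g g′} → f ≈ f′ → g ≈ g′ → f ∙ g ≈ f′ ∙ g′
∙-cong p q = limit λ N → ∙-below (truncate p) (truncate q)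

∙-comm : ∀ f g → f ∙ g ≈ g ∙ f
∙-comm f g = mk (go f g)
  where
  go : ∀ f g n → (f ∙ g) n ≡ (g ∙ f) n
  go f g zero = ≡.trans (∙-zero f g) (≡.trans (ℤ.*-comm (f 0) (g 0)) (≡.sym (∙-zero g f)))
  go f g (suc n) = begin
    (f ∙ g) (suc n)
      ≡⟨ ∙-suc f g n ⟩
    f 0 ℤ.* g (suc n) ℤ.+ (tail f ∙ g) n
      ≡⟨ cong₂ ℤ._+_ (ℤ.*-comm (f 0) (g (suc n))) (go (tail f) g n) ⟩
    g (suc n) ℤ.* f 0 ℤ.+ (g ∙ tail f) n
      ≡⟨ ℤ.+-comm (g (suc n) ℤ.* f 0) _ ⟩
    (g ∙ tail f) n ℤ.+ g (suc n) ℤ.* f 0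
      ≡⟨ ∙-sucʳ g f n ⟨
    (g ∙ f) (suc n) ∎
    where open ≡.≡-Reasoning

∙-distribʳ : ∀ h f g → (f ⊞ g) ∙ h ≈ (f ∙ h) ⊞ (g ∙ h)
∙-distribʳ h f g = mk λ n → ≡.trans (go f g n) (≡.sym (⊞-at (f ∙ h) (g ∙ h) n))
  where
  open ≡.≡-Reasoning
  ring : ∀ a b c x y → (a ℤ.+ b) ℤ.* c ℤ.+ (x ℤ.+ y) ≡ a ℤ.* c ℤ.+ x ℤ.+ (b ℤ.* c ℤ.+ y)
  ring = ℤSolver.solve-∀
  go : ∀ f g n → ((f ⊞ g) ∙ h) n ≡ (f ∙ h) n ℤ.+ (g ∙ h) n
  go f g zero = begin
    ((f ⊞ g) ∙ h) 0                   ≡⟨ ∙-zero (f ⊞ g) h ⟩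
    (f ⊞ g) 0 ℤ.* h 0                 ≡⟨ cong (ℤ._* h 0) (⊞-at f g 0) ⟩
    (f 0 ℤ.+ g 0) ℤ.* h 0             ≡⟨ ℤ.*-distribʳ-+ (h 0) (f 0) (g 0) ⟩
    f 0 ℤ.* h 0 ℤ.+ g 0 ℤ.* h 0       ≡⟨ cong₂ ℤ._+_ (∙-zero f h) (∙-zero g h) ⟨
    (f ∙ h) 0 ℤ.+ (g ∙ h) 0           ∎
  go f g (suc n) = begin
    ((f ⊞ g) ∙ h) (suc n)
      ≡⟨ ∙-suc (f ⊞ g) h n ⟩
    (f ⊞ g) 0 ℤ.* h (suc n) ℤ.+ (tail (f ⊞ g) ∙ h) n
      ≡⟨ cong₂ ℤ._+_ (cong (ℤ._* h (suc n)) (⊞-at f g 0))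
           (≡.trans (at (∙-cong {g = h}
             (mk λ i → ≡.trans (⊞-at f g (suc i)) (≡.sym (⊞-at (tail f) (tail g) i))) (mk λ _ → ≡.refl)) n)
                    (go (tail f) (tail g) n)) ⟩
    (f 0 ℤ.+ g 0) ℤ.* h (suc n) ℤ.+ ((tail f ∙ h) n ℤ.+ (tail g ∙ h) n)
      ≡⟨ ring (f 0) (g 0) (h (suc n)) _ _ ⟩
    f 0 ℤ.* h (suc n) ℤ.+ (tail f ∙ h) n ℤ.+ (g 0 ℤ.* h (suc n) ℤ.+ (tail g ∙ h) n)
      ≡⟨ cong₂ ℤ._+_ (∙-suc f h n) (∙-suc g h n) ⟨
    (f ∙ h) (suc n) ℤ.+ (g ∙ h) (suc n) ∎

const-∙ : ∀ c f n → (const c ∙ f) n ≡ c ℤ.* f n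
const-∙ c f zero    = ∙-zero (const c) f
const-∙ c f (suc n) = begin
  (const c ∙ f) (suc n)                     ≡⟨ ∙-suc (const c) f n ⟩
  c ℤ.* f (suc n) ℤ.+ (tail (const c) ∙ f) n ≡⟨ cong (λ z → c ℤ.* f (suc n) ℤ.+ z) (null f n) ⟩
  c ℤ.* f (suc n) ℤ.+ 0ℤ                    ≡⟨ ℤ.+-identityʳ _ ⟩
  c ℤ.* f (suc n)                           ∎
  where
  open ≡.≡-Reasoning
  null : ∀ f n → (tail (const c) ∙ f) n ≡ 0ℤ
  null f zero    = ∙-zero (tail (const c)) f
  null f (suc n) = ≡.trans (∙-suc (tail (const c)) f n) (≡.trans (ℤ.+-identityˡ _) (null f n))

-- A Leibniz rule. Its second summand keeps the right factor whole, so that inductions may run over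
-- the left factor alone.
tail-∙ : ∀ f g → tail (f ∙ g) ≈ const (f 0) ∙ tail g ⊞ tail f ∙ g
tail-∙ f g = mk λ n → begin
  (f ∙ g) (suc n)                                ≡⟨ ∙-suc f g n ⟩
  f 0 ℤ.* g (suc n) ℤ.+ (tail f ∙ g) n           ≡⟨ cong (ℤ._+ (tail f ∙ g) n) (const-∙ (f 0) (tail g) n) ⟨
  (const (f 0) ∙ tail g) n ℤ.+ (tail f ∙ g) n    ≡⟨ ⊞-at (const (f 0) ∙ tail g) (tail f ∙ g) n ⟨
  (const (f 0) ∙ tail g ⊞ tail f ∙ g) n          ∎
  where open ≡.≡-Reasoning

∙-assoc : ∀ f g h → f ∙ g ∙ h ≈ f ∙ (g ∙ h)
∙-assoc f g h = mk (go f g h)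
  where
  open ≡.≡-Reasoning
  ring : ∀ a b c x y → a ℤ.* b ℤ.* c ℤ.+ (a ℤ.* x ℤ.+ y) ≡ a ℤ.* (b ℤ.* c ℤ.+ x) ℤ.+ y
  ring = ℤSolver.solve-∀
  scalar : ∀ c f h n → (const c ∙ f ∙ h) n ≡ c ℤ.* (f ∙ h) n
  scalar c f h zero = begin
    (const c ∙ f ∙ h) 0        ≡⟨ ∙-zero (const c ∙ f) h ⟩
    (const c ∙ f) 0 ℤ.* h 0    ≡⟨ cong (ℤ._* h 0) (const-∙ c f 0) ⟩
    c ℤ.* f 0 ℤ.* h 0          ≡⟨ ℤ.*-assoc c (f 0) (h 0) ⟩
    c ℤ.* (f 0 ℤ.* h 0)        ≡⟨ cong (c ℤ.*_) (∙-zero f h) ⟨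
    c ℤ.* (f ∙ h) 0            ∎
  scalar c f h (suc n) = begin
    (const c ∙ f ∙ h) (suc n)
      ≡⟨ ∙-suc (const c ∙ f) h n ⟩
    (const c ∙ f) 0 ℤ.* h (suc n) ℤ.+ (tail (const c ∙ f) ∙ h) n
      ≡⟨ cong₂ ℤ._+_ (cong (ℤ._* h (suc n)) (const-∙ c f 0))
           (≡.trans (at (∙-cong {tail (const c ∙ f)} {const c ∙ tail f} {h}
             (mk λ i → ≡.trans (const-∙ c f (suc i)) (≡.sym (const-∙ c (tail f) i))) (mk λ _ → ≡.refl)) n)
                    (scalar c (tail f) h n)) ⟩
    c ℤ.* f 0 ℤ.* h (suc n) ℤ.+ c ℤ.* (tail f ∙ h) n
      ≡⟨ cong (ℤ._+ c ℤ.* (tail f ∙ h) n) (ℤ.*-assoc c (f 0) (h (suc n))) ⟩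
    c ℤ.* (f 0 ℤ.* h (suc n)) ℤ.+ c ℤ.* (tail f ∙ h) n
      ≡⟨ ℤ.*-distribˡ-+ c _ _ ⟨
    c ℤ.* (f 0 ℤ.* h (suc n) ℤ.+ (tail f ∙ h) n)
      ≡⟨ cong (c ℤ.*_) (∙-suc f h n) ⟨
    c ℤ.* (f ∙ h) (suc n) ∎
  go : ∀ f g h n → (f ∙ g ∙ h) n ≡ (f ∙ (g ∙ h)) n
  go f g h zero = begin
    (f ∙ g ∙ h) 0              ≡⟨ ∙-zero (f ∙ g) h ⟩
    (f ∙ g) 0 ℤ.* h 0          ≡⟨ cong (ℤ._* h 0) (∙-zero f g) ⟩
    f 0 ℤ.* g 0 ℤ.* h 0        ≡⟨ ℤ.*-assoc (f 0) (g 0) (h 0) ⟩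
    f 0 ℤ.* (g 0 ℤ.* h 0)      ≡⟨ cong (f 0 ℤ.*_) (∙-zero g h) ⟨
    f 0 ℤ.* (g ∙ h) 0          ≡⟨ ∙-zero f (g ∙ h) ⟨
    (f ∙ (g ∙ h)) 0            ∎
  go f g h (suc n) = begin
    (f ∙ g ∙ h) (suc n)
      ≡⟨ ∙-suc (f ∙ g) h n ⟩
    (f ∙ g) 0 ℤ.* h (suc n) ℤ.+ (tail (f ∙ g) ∙ h) n
      ≡⟨ cong₂ ℤ._+_ (cong (ℤ._* h (suc n)) (∙-zero f g))
           (at (∙-cong {g = h} (tail-∙ f g) (mk λ _ → ≡.refl)) n) ⟩
    f 0 ℤ.* g 0 ℤ.* h (suc n) ℤ.+ ((const (f 0) ∙ tail g ⊞ tail f ∙ g) ∙ h) n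
      ≡⟨ cong (λ z → f 0 ℤ.* g 0 ℤ.* h (suc n) ℤ.+ z) (≡.trans (at (∙-distribʳ h (const (f 0) ∙ tail g) (tail f ∙ g)) n)
           (≡.trans (⊞-at _ _ n) (cong₂ ℤ._+_ (scalar (f 0) (tail g) h n) (go (tail f) g h n)))) ⟩
    f 0 ℤ.* g 0 ℤ.* h (suc n) ℤ.+ (f 0 ℤ.* (tail g ∙ h) n ℤ.+ (tail f ∙ (g ∙ h)) n)
      ≡⟨ ring (f 0) (g 0) (h (suc n)) _ _ ⟩
    f 0 ℤ.* (g 0 ℤ.* h (suc n) ℤ.+ (tail g ∙ h) n) ℤ.+ (tail f ∙ (g ∙ h)) n
      ≡⟨ cong (λ x → f 0 ℤ.* x ℤ.+ (tail f ∙ (g ∙ h)) n) (∙-suc g h n) ⟨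
    f 0 ℤ.* (g ∙ h) (suc n) ℤ.+ (tail f ∙ (g ∙ h)) n
      ≡⟨ ∙-suc f (g ∙ h) n ⟨
    (f ∙ (g ∙ h)) (suc n) ∎

≈-isEquivalence : IsEquivalence _≈_
≈-isEquivalence = record
  { refl  = mk λ _ → ≡.refl
  ; sym   = λ p → mk λ n → ≡.sym (at p n)
  ; trans = λ p q → mk λ n → ≡.trans (at p n) (at q n)
  }

∙-identityˡ : ∀ f → const 1ℤ ∙ f ≈ f
∙-identityˡ f = mk λ n → ≡.trans (const-∙ 1ℤ f n) (ℤ.*-identityˡ (f n))

∙-distribˡ : ∀ h f g → h ∙ (f ⊞ g) ≈ (h ∙ f) ⊞ (h ∙ g)
∙-distribˡ h f g = trans (∙-comm h (f ⊞ g)) (trans (∙-distribʳ h f g)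
  (mk λ n → ≡.trans (⊞-at _ _ n) (≡.trans (cong₂ ℤ._+_ (at (∙-comm f h) n) (at (∙-comm g h) n)) (≡.sym (⊞-at _ _ n)))))
  where open IsEquivalence ≈-isEquivalence

opaque
  unfolding _⊞_
  ⊞-cong : ∀ {f f′ g g′} → f ≈ f′ → g ≈ g′ → f ⊞ g ≈ f′ ⊞ g′
  ⊞-cong p q = mk λ n → cong₂ ℤ._+_ (at p n) (at q n)
  ⊟-cong : ∀ {f f′} → f ≈ f′ → ⊟ f ≈ ⊟ f′
  ⊟-cong p = mk λ n → cong ℤ.-_ (at p n)
  ⊞-assoc : ∀ f g h → f ⊞ g ⊞ h ≈ f ⊞ (g ⊞ h)
  ⊞-assoc f g h = mk λ n → ℤ.+-assoc (f n) (g n) (h n)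
  ⊞-comm : ∀ f g → f ⊞ g ≈ g ⊞ f
  ⊞-comm f g = mk λ n → ℤ.+-comm (f n) (g n)
  ⊞-identityˡ : ∀ f → const 0ℤ ⊞ f ≈ f
  ⊞-identityˡ f = mk λ { zero → ℤ.+-identityˡ _ ; (suc n) → ℤ.+-identityˡ _ }
  ⊟-inverseˡ : ∀ f → ⊟ f ⊞ f ≈ const 0ℤ
  ⊟-inverseˡ f = mk λ { zero → ℤ.+-inverseˡ (f 0) ; (suc n) → ℤ.+-inverseˡ (f (suc n)) }
  const-⊞ : ∀ a b → const (a ℤ.+ b) ≈ const a ⊞ const b
  const-⊞ a b = mk λ { zero → ≡.refl ; (suc n) → ≡.refl }
  const-⊟ : ∀ a → const (ℤ.- a) ≈ ⊟ const a
  const-⊟ a = mk λ { zero → ≡.refl ; (suc n) → ≡.refl }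

const-* : ∀ a b → const (a ℤ.* b) ≈ const a ∙ const b
const-* a b = mk λ
  { zero    → ≡.sym (const-∙ a (const b) 0)
  ; (suc n) → ≡.sym (≡.trans (const-∙ a (const b) (suc n)) (ℤ.*-zeroʳ a))
  }

seriesRing : CommutativeRing 0ℓ 0ℓ
seriesRing = record
  { Carrier = PowerSeries
  ; _≈_ = _≈_
  ; _+_ = _⊞_
  ; _*_ = _∙_
  ; -_  = ⊟_
  ; 0#  = const 0ℤ
  ; 1#  = const 1ℤ
  ; isCommutativeRing = record
    { isRing = record
      { +-isAbelianGroup = record
        { isGroup = record
          { isMonoid = record
            { isSemigroup = record
              { isMagma = record { isEquivalence = ≈-isEquivalence ; ∙-cong = ⊞-cong }
              ; assoc = ⊞-assoc
              }
            ; identity = ⊞-identityˡ , λ f → trans (⊞-comm f _) (⊞-identityˡ f)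
            }
          ; inverse = ⊟-inverseˡ , λ f → trans (⊞-comm f _) (⊟-inverseˡ f)
          ; ⁻¹-cong = ⊟-cong
          }
        ; comm = ⊞-comm
        }
      ; *-cong = ∙-cong
      ; *-assoc = ∙-assoc
      ; *-identity = ∙-identityˡ , λ f → trans (∙-comm f _) (∙-identityˡ f)
      ; distrib = ∙-distribˡ , ∙-distribʳ
      }
    ; *-comm = ∙-comm
    }
  }
  where open IsEquivalence ≈-isEquivalence

module R = CommutativeRing seriesRing
open R using (refl; sym; trans; setoid; _-_)
open Algebra.Properties.CommutativeSemiring.Exp R.commutativeSemiring using ()
  renaming (_^_ to infixr 8 _↑_; ^-congˡ to ↑-cong; ^-assocʳ to ↑-assoc; ^-distrib-* to ∙-↑)

ℤ⟶series : CommutativeRing.rawRing ℤ.+-*-commutativeRing -Raw-AlmostCommutative⟶ fromCommutativeRing seriesRing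
ℤ⟶series = record
  { ⟦_⟧    = const
  ; +-homo = const-⊞
  ; *-homo = const-*
  ; -‿homo = const-⊟
  ; 0-homo = refl
  ; 1-homo = refl
  }

weakly-decide : ∀ a b → Maybe (const a ≈ const b)
weakly-decide a b with a ℤ.≟ b
... | yes p = just (≡.subst (λ c → const a ≈ const c) p refl)
... | no _  = nothing

open Algebra.Solver.Ring (CommutativeRing.rawRing ℤ.+-*-commutativeRing)
  (fromCommutativeRing seriesRing) ℤ⟶series weakly-decide
  using (solve; _:=_; con; _:+_; _:*_; _:-_; :-_; _:^_)

-- Truncation and composition

truncatedSetoid : ℕ → Setoid 0ℓ 0ℓ
truncatedSetoid N = record
  { Carrier = PowerSeries
  ; _≈_ = _≈[ N ]_
  ; isEquivalence = record
    { refl  = mk λ _ → ≡.refl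
    ; sym   = λ p → mk λ n<N → ≡.sym (below p n<N)
    ; trans = λ p q → mk λ n<N → ≡.trans (below p n<N) (below q n<N)
    }
  }

module T {N} = Setoid (truncatedSetoid N)

module ≈-Reasoning = SetoidReasoning setoid
module T-Reasoning N = SetoidReasoning (truncatedSetoid N)

⊞-below : ∀ {N f f′ g g′} → f ≈[ N ] f′ → g ≈[ N ] g′ → f ⊞ g ≈[ N ] f′ ⊞ g′
⊞-below {f = f} {f′} {g} {g′} p q = mk λ {n} n<N →
  ≡.trans (⊞-at f g n) (≡.trans (cong₂ ℤ._+_ (below p n<N) (below q n<N)) (≡.sym (⊞-at f′ g′ n)))

weaken : ∀ {M N f g} → M ≤ N → f ≈[ N ] g → f ≈[ M ] g
weaken M≤N p = mk λ n<M → below p (ℕ.≤-trans n<M M≤N)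

-- The engine of the inductions on precision: a recursion f = c + y·f′ in which y has no constant
-- term gains one coefficient at each use.
∙-raise : ∀ {N y f g} → y 0 ≡ 0ℤ → f ≈[ N ] g → y ∙ f ≈[ suc N ] y ∙ g
∙-raise {N} {y} {f} {g} y0 p = mk λ
  { {zero}  _         → ≡.trans (vanish f) (≡.sym (vanish g))
  ; {suc n} (s≤s n<N) → ≡.trans (drop f n) (≡.trans (below (∙-below T.refl p) n<N) (≡.sym (drop g n)))
  }
  where
  vanish : ∀ f → (y ∙ f) 0 ≡ 0ℤ
  vanish f = ≡.trans (∙-zero y f) (cong (ℤ._* f 0) y0)
  drop : ∀ f n → (y ∙ f) (suc n) ≡ (tail y ∙ f) n
  drop f n = ≡.trans (∙-suc y f n)
    (≡.trans (cong (λ a → a ℤ.* f (suc n) ℤ.+ (tail y ∙ f) n) y0) (ℤ.+-identityˡ _))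

horner : PowerSeries → PowerSeries → ℕ → PowerSeries
horner y c zero    = const 0ℤ
horner y c (suc N) = const (c 0) ⊞ y ∙ horner y (tail c) N

-- The composition c(y) = Σ cᵢ yⁱ, meaningful when y has constant term 0.
ev : PowerSeries → PowerSeries → PowerSeries
ev y c n = horner y c (suc n) n

horner-cong : ∀ {y y′ N c d} → y ≈ y′ → c ≈[ N ] d → horner y c N ≈ horner y′ d N
horner-cong {N = zero}  y≈y′ p = refl
horner-cong {y} {N = suc N} {c} {d} y≈y′ p = R.+-cong
  (R.reflexive (cong const (below p (s≤s z≤n))))
  (R.*-cong y≈y′ (horner-cong y≈y′ (mk λ i<N → below p (s≤s i<N))))

ev-congˡ : ∀ {y y′} c → y ≈ y′ → ev y c ≈ ev y′ c
ev-congˡ c y≈y′ = mk λ n → at (horner-cong {N = suc n} {c = c} y≈y′ T.refl) n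

ev-below : ∀ {N c d} y → c ≈[ N ] d → ev y c ≈[ N ] ev y d
ev-below y p = mk λ {n} n<N → at (horner-cong {y} refl (weaken n<N p)) n

ev-cong : ∀ {c d} y → c ≈ d → ev y c ≈ ev y d
ev-cong y p = limit λ N → ev-below y (truncate p)

X : PowerSeries
X = q^ 1

module _ {y : PowerSeries} (y0 : y 0 ≡ 0ℤ) where

  -- The coefficients of c from index M on enter with a factor y^M = O(q^M). This justifies reading
  -- coefficient n of `ev` off n + 1 Horner steps.
  horner-stable : ∀ c {M N} → M ≤ N → horner y c M ≈[ M ] horner y c N
  horner-stable c z≤n       = mk λ ()
  horner-stable c (s≤s M≤N) = ⊞-below T.refl (∙-raise y0 (horner-stable (tail c) M≤N))

  ev-horner : ∀ c N → ev y c ≈[ N ] horner y c N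
  ev-horner c N = mk λ n<N → below (horner-stable c n<N) ℕ.≤-refl

  ev-unfold : ∀ c → ev y c ≈ const (c 0) ⊞ y ∙ ev y (tail c)
  ev-unfold c = limit go
    where
    go : ∀ N → ev y c ≈[ N ] const (c 0) ⊞ y ∙ ev y (tail c)
    go zero    = mk λ ()
    go (suc N) = T.trans (ev-horner c (suc N))
      (⊞-below T.refl (∙-raise y0 (T.sym (ev-horner (tail c) N))))

  ev-zero : ∀ c → ev y c 0 ≡ c 0
  ev-zero c = ≡.trans (at (ev-unfold c) 0) (≡.trans (⊞-at (const (c 0)) (y ∙ ev y (tail c)) 0)
    (≡.trans (cong (λ z → c 0 ℤ.+ z) (≡.trans (∙-zero y (ev y (tail c)))
      (cong (λ a → a ℤ.* ev y (tail c) 0) y0))) (ℤ.+-identityʳ (c 0))))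

  ev-⊞ : ∀ c d → ev y (c ⊞ d) ≈ ev y c ⊞ ev y d
  ev-⊞ c d = limit λ N → go N c d
    where
    go : ∀ N c d → ev y (c ⊞ d) ≈[ N ] ev y c ⊞ ev y d
    go zero    c d = mk λ ()
    go (suc N) c d = begin
      ev y (c ⊞ d)
        ≈⟨ truncate (ev-unfold (c ⊞ d)) ⟩
      const ((c ⊞ d) 0) ⊞ y ∙ ev y (tail (c ⊞ d))
        ≈⟨ ⊞-below
             (T.trans (T.reflexive (cong const (⊞-at c d 0))) (truncate (const-⊞ (c 0) (d 0))))
             (∙-raise y0 (T.trans
               (truncate (ev-cong y (mk λ n → ≡.trans (⊞-at c d (suc n)) (≡.sym (⊞-at (tail c) (tail d) n)))))
               (go N (tail c) (tail d)))) ⟩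
      const (c 0) ⊞ const (d 0) ⊞ y ∙ (ev y (tail c) ⊞ ev y (tail d))
        ≈⟨ truncate (solve 5 (λ a b y c d → a :+ b :+ y :* (c :+ d)
             := (a :+ y :* c) :+ (b :+ y :* d)) refl _ _ _ _ _) ⟩
      (const (c 0) ⊞ y ∙ ev y (tail c)) ⊞ (const (d 0) ⊞ y ∙ ev y (tail d))
        ≈⟨ truncate (R.+-cong (ev-unfold c) (ev-unfold d)) ⟨
      ev y c ⊞ ev y d ∎
      where open T-Reasoning (suc N)

  ev-const : ∀ a → ev y (const a) ≈ const a
  ev-const a = begin
    ev y (const a)                     ≈⟨ ev-unfold (const a) ⟩
    const a ⊞ y ∙ ev y (tail (const a)) ≈⟨ R.+-congˡ (R.*-congˡ zero≈) ⟩
    const a ⊞ y ∙ const 0ℤ             ≈⟨ R.+-congˡ (R.zeroʳ y) ⟩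
    const a ⊞ const 0ℤ                 ≈⟨ R.+-identityʳ _ ⟩
    const a                            ∎
    where
    open ≈-Reasoning
    zero≈ : ev y (tail (const a)) ≈ const 0ℤ
    zero≈ = limit go
      where
      go : ∀ N → ev y (tail (const a)) ≈[ N ] const 0ℤ
      go zero    = mk λ ()
      go (suc N) = T.trans (truncate (ev-unfold (tail (const a))))
        (T.trans (⊞-below T.refl (T.trans (∙-raise y0 (go N)) (truncate (R.zeroʳ y))))
                 (truncate (R.+-identityʳ _)))

  ev-scale : ∀ a c → ev y (const a ∙ c) ≈ const a ∙ ev y c
  ev-scale a c = limit λ N → go N c
    where
    go : ∀ N c → ev y (const a ∙ c) ≈[ N ] const a ∙ ev y c
    go zero    c = mk λ ()
    go (suc N) c = begin
      ev y (const a ∙ c)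
        ≈⟨ truncate (ev-unfold (const a ∙ c)) ⟩
      const ((const a ∙ c) 0) ⊞ y ∙ ev y (tail (const a ∙ c))
        ≈⟨ ⊞-below
             (T.trans (T.reflexive (cong const (const-∙ a c 0))) (truncate (const-* a (c 0))))
             (∙-raise y0 (T.trans
               (truncate (ev-cong y (mk λ n → ≡.trans (const-∙ a c (suc n)) (≡.sym (const-∙ a (tail c) n)))))
               (go N (tail c)))) ⟩
      const a ∙ const (c 0) ⊞ y ∙ (const a ∙ ev y (tail c))
        ≈⟨ truncate (solve 4 (λ a b y c → a :* b :+ y :* (a :* c) := a :* (b :+ y :* c)) refl _ _ _ _) ⟩
      const a ∙ (const (c 0) ⊞ y ∙ ev y (tail c))
        ≈⟨ truncate (R.*-congˡ (ev-unfold c)) ⟨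
      const a ∙ ev y c ∎
      where open T-Reasoning (suc N)

  -- The induction is on the precision: the tails produced by `tail-∙` appear under a factor y, and
  -- `∙-raise` pays for them.
  ev-∙ : ∀ c d → ev y (c ∙ d) ≈ ev y c ∙ ev y d
  ev-∙ c d = limit λ N → go N c
    where
    go : ∀ N c → ev y (c ∙ d) ≈[ N ] ev y c ∙ ev y d
    go zero    c = mk λ ()
    go (suc N) c = begin
      ev y (c ∙ d)
        ≈⟨ truncate (ev-unfold (c ∙ d)) ⟩
      const ((c ∙ d) 0) ⊞ y ∙ ev y (tail (c ∙ d))
        ≈⟨ ⊞-below
             (T.trans (T.reflexive (cong const (∙-zero c d))) (truncate (const-* (c 0) (d 0))))
             (∙-raise y0 (T.trans
               (truncate (trans (ev-cong y (tail-∙ c d))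
                 (trans (ev-⊞ (const (c 0) ∙ tail d) (tail c ∙ d)) (R.+-congʳ (ev-scale (c 0) (tail d))))))
               (⊞-below T.refl (go N (tail c))))) ⟩
      const (c 0) ∙ const (d 0) ⊞ y ∙ (const (c 0) ∙ ev y (tail d) ⊞ ev y (tail c) ∙ ev y d)
        ≈⟨ truncate (solve 6 (λ a b y c d e → a :* b :+ y :* (a :* d :+ c :* e)
             := a :* (b :+ y :* d) :+ y :* c :* e) refl _ _ _ _ _ _) ⟩
      const (c 0) ∙ (const (d 0) ⊞ y ∙ ev y (tail d)) ⊞ y ∙ ev y (tail c) ∙ ev y d
        ≈⟨ truncate (R.+-congʳ (R.*-congˡ (ev-unfold d))) ⟨
      const (c 0) ∙ ev y d ⊞ y ∙ ev y (tail c) ∙ ev y d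
        ≈⟨ truncate (R.distribʳ (ev y d) _ _) ⟨
      (const (c 0) ⊞ y ∙ ev y (tail c)) ∙ ev y d
        ≈⟨ truncate (R.*-congʳ (ev-unfold c)) ⟨
      ev y c ∙ ev y d ∎
      where open T-Reasoning (suc N)

  ev-⊟ : ∀ c → ev y (⊟ c) ≈ ⊟ ev y c
  ev-⊟ c = begin
    ev y (⊟ c)                 ≈⟨ ev-cong y (solve 1 (λ c → :- c := con (ℤ.- 1ℤ) :* c) refl c) ⟩
    ev y (const (ℤ.- 1ℤ) ∙ c)  ≈⟨ ev-scale (ℤ.- 1ℤ) c ⟩
    const (ℤ.- 1ℤ) ∙ ev y c    ≈⟨ solve 1 (λ c → con (ℤ.- 1ℤ) :* c := :- c) refl (ev y c) ⟩
    ⊟ ev y c                   ∎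
    where open ≈-Reasoning

  ev-↑ : ∀ c n → ev y (c ↑ n) ≈ ev y c ↑ n
  ev-↑ c zero    = ev-const 1ℤ
  ev-↑ c (suc n) = trans (ev-∙ c (c ↑ n)) (R.*-congˡ (ev-↑ c n))

  ev-X : ev y X ≈ y
  ev-X = begin
    ev y X                       ≈⟨ ev-unfold X ⟩
    const 0ℤ ⊞ y ∙ ev y (tail X) ≈⟨ R.+-identityˡ _ ⟩
    y ∙ ev y (tail X)            ≈⟨ R.*-congˡ (trans (ev-cong {tail X} {const 1ℤ} y
                                       (mk λ { zero → ≡.refl ; (suc n) → ≡.refl })) (ev-const 1ℤ)) ⟩
    y ∙ const 1ℤ                 ≈⟨ R.*-identityʳ y ⟩
    y                            ∎
    where open ≈-Reasoning

ev-ev : ∀ {y z} → y 0 ≡ 0ℤ → z 0 ≡ 0ℤ → ∀ c → ev y (ev z c) ≈ ev (ev y z) c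
ev-ev {y} {z} y0 z0 c = limit λ N → go N c
  where
  yz0 : ev y z 0 ≡ 0ℤ
  yz0 = ≡.trans (ev-zero y0 z) z0
  go : ∀ N c → ev y (ev z c) ≈[ N ] ev (ev y z) c
  go zero    c = mk λ ()
  go (suc N) c = begin
    ev y (ev z c)
      ≈⟨ truncate (trans (ev-cong y (ev-unfold z0 c)) (ev-⊞ y0 (const (c 0)) (z ∙ ev z (tail c)))) ⟩
    ev y (const (c 0)) ⊞ ev y (z ∙ ev z (tail c))
      ≈⟨ truncate (R.+-cong (ev-const y0 (c 0)) (ev-∙ y0 z (ev z (tail c)))) ⟩
    const (c 0) ⊞ ev y z ∙ ev y (ev z (tail c))
      ≈⟨ ⊞-below T.refl (∙-raise yz0 (go N (tail c))) ⟩
    const (c 0) ⊞ ev y z ∙ ev (ev y z) (tail c)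
      ≈⟨ truncate (ev-unfold yz0 c) ⟨
    ev (ev y z) c ∎
    where open T-Reasoning (suc N)

-- Powers of q, inverses and cancellation

1ₛ≈1 : 1ₛ ≈ const 1ℤ
1ₛ≈1 = mk λ { zero → ≡.refl ; (suc n) → ≡.refl }

opaque
  unfolding _⊞_
  1-q^≈ : ∀ m → 1-q^ m ≈ const 1ℤ - (q^ m)
  1-q^≈ m = mk λ { zero → ≡.refl ; (suc n) → ≡.refl }

X∙-zero : ∀ f → (X ∙ f) 0 ≡ 0ℤ
X∙-zero f = ∙-zero X f

X∙-suc : ∀ f n → (X ∙ f) (suc n) ≡ f n
X∙-suc f n = ≡.trans (∙-suc X f n) (≡.trans (ℤ.+-identityˡ _)
  (at (trans (R.*-congʳ (mk λ { zero → ≡.refl ; (suc n) → ≡.refl })) (R.*-identityˡ f)) n))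

q^≈X↑ : ∀ m → q^ m ≈ X ↑ m
q^≈X↑ zero    = 1ₛ≈1
q^≈X↑ (suc m) = mk λ
  { zero    → ≡.sym (X∙-zero (X ↑ m))
  ; (suc n) → ≡.trans (at (q^≈X↑ m) n) (≡.sym (X∙-suc (X ↑ m) n))
  }

-- The geometric series evaluated at 1 − f; the inverse of f when f has constant term 1.
inv : PowerSeries → PowerSeries
inv f = ev (const 1ℤ - f) (1/1-q^ 1)

1-f-zero : ∀ {f} → f 0 ≡ 1ℤ → (const 1ℤ - f) 0 ≡ 0ℤ
1-f-zero {f} f0 = ≡.trans (⊞-at (const 1ℤ) (⊟ f) 0)
  (cong (λ z → 1ℤ ℤ.+ z) (≡.trans (⊟-at f 0) (cong ℤ.-_ f0)))

-- The identity (1 - q)·Σ qʲ = 1 is carried along the substitution q ↦ 1 - f, under which 1 - q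
-- becomes f.
inv-inverse : ∀ {f} → f 0 ≡ 1ℤ → f ∙ inv f ≈ const 1ℤ
inv-inverse {f} f0 = begin
  f ∙ inv f
    ≈⟨ R.*-congʳ (solve 1 (λ f → f := con 1ℤ :- (con 1ℤ :- f)) refl f) ⟩
  (const 1ℤ - y) ∙ inv f
    ≈⟨ R.*-congʳ (R.+-cong (ev-const y0 1ℤ) (trans (ev-⊟ y0 X) (R.-‿cong (ev-X y0)))) ⟨
  (ev y (const 1ℤ) ⊞ ev y (⊟ X)) ∙ inv f
    ≈⟨ R.*-congʳ (trans (ev-cong y (1-q^≈ 1)) (ev-⊞ y0 (const 1ℤ) (⊟ X))) ⟨
  ev y (1-q^ 1) ∙ inv f
    ≈⟨ ev-∙ y0 (1-q^ 1) (1/1-q^ 1) ⟨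
  ev y ((1-q^ 1) ∙ (1/1-q^ 1))
    ≈⟨ ev-cong y (trans (sym (⊛≈∙ (1-q^ 1) (1/1-q^ 1))) (trans (mk (1-q^-inverse 1)) 1ₛ≈1)) ⟩
  ev y (const 1ℤ)
    ≈⟨ ev-const y0 1ℤ ⟩
  const 1ℤ ∎
  where
  open ≈-Reasoning
  y = const 1ℤ - f
  y0 = 1-f-zero f0

-- Stands in for division: identities with denominators are multiplied out and then freed of the
-- common unit, also when they are known only modulo q^N.
∙-cancel-below : ∀ {N f g h} → f 0 ≡ 1ℤ → f ∙ g ≈[ N ] f ∙ h → g ≈[ N ] h
∙-cancel-below {N} {f} {g} {h} f0 p = begin
  g               ≈⟨ truncate (expand g) ⟩
  inv f ∙ (f ∙ g) ≈⟨ ∙-below T.refl p ⟩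
  inv f ∙ (f ∙ h) ≈⟨ truncate (expand h) ⟨
  h               ∎
  where
  open T-Reasoning N
  expand : ∀ g → g ≈ inv f ∙ (f ∙ g)
  expand g = trans (sym (R.*-identityˡ g)) (trans (R.*-congʳ (sym (inv-inverse f0)))
    (solve 3 (λ f i g → f :* i :* g := i :* (f :* g)) refl f (inv f) g))

∙-cancel : ∀ {f g h} → f 0 ≡ 1ℤ → f ∙ g ≈ f ∙ h → g ≈ h
∙-cancel f0 p = limit λ N → ∙-cancel-below f0 (truncate p)

-- The operator U₄

X⁴ : PowerSeries
X⁴ = X ↑ 4

X⁴-zero : X⁴ 0 ≡ 0ℤ
X⁴-zero = X∙-zero (X ↑ 3)

U : PowerSeries → PowerSeries
U f n = f (n ℕ.* 4)

U-cong : ∀ {f g} → f ≈ g → U f ≈ U g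
U-cong p = mk λ n → at p (n ℕ.* 4)

U-⊞ : ∀ f g → U (f ⊞ g) ≈ U f ⊞ U g
U-⊞ f g = mk λ n → ≡.trans (⊞-at f g (n ℕ.* 4)) (≡.sym (⊞-at (U f) (U g) n))

U-scale : ∀ a f → U (const a ∙ f) ≈ const a ∙ U f
U-scale a f = mk λ n → ≡.trans (const-∙ a f (n ℕ.* 4)) (≡.sym (const-∙ a (U f) n))

U-X⁴∙ : ∀ f → U (X⁴ ∙ f) ≈ X ∙ U f
U-X⁴∙ f = trans (U-cong (solve 2 (λ x f → x :^ 4 :* f := x :* (x :* (x :* (x :* f)))) refl X f)) (mk λ
  { zero    → ≡.trans (X∙-zero _) (≡.sym (X∙-zero _))
  ; (suc n) → ≡.trans (X∙-suc _ _) (≡.trans (X∙-suc _ _) (≡.trans (X∙-suc _ _)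
                (≡.trans (X∙-suc f (n ℕ.* 4)) (≡.sym (X∙-suc (U f) n)))))
  })

unfold-X : ∀ f → f ≈ const (f 0) ⊞ X ∙ tail f
unfold-X f = mk λ
  { zero    → ≡.sym (≡.trans (⊞-at (const (f 0)) (X ∙ tail f) 0)
                (≡.trans (cong (λ z → f 0 ℤ.+ z) (X∙-zero (tail f))) (ℤ.+-identityʳ (f 0))))
  ; (suc n) → ≡.sym (≡.trans (⊞-at (const (f 0)) (X ∙ tail f) (suc n))
                (≡.trans (ℤ.+-identityˡ _) (X∙-suc (tail f) n)))
  }

-- Linearity of U over series in q⁴: a factor f(q⁴) leaves U as f. Each q⁴ split off the factor
-- leaves as one q, so the precision grows by one.
U-ev : ∀ f g → U (ev X⁴ f ∙ g) ≈ f ∙ U g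
U-ev f g = limit λ N → go N f
  where
  go : ∀ N f → U (ev X⁴ f ∙ g) ≈[ N ] f ∙ U g
  go zero    f = mk λ ()
  go (suc N) f = begin
    U (ev X⁴ f ∙ g)
      ≈⟨ truncate (U-cong (trans (R.*-congʳ (ev-unfold X⁴-zero f))
           (solve 4 (λ a x e g → (a :+ x :* e) :* g := a :* g :+ x :* (e :* g)) refl _ _ _ _))) ⟩
    U (const (f 0) ∙ g ⊞ X⁴ ∙ (ev X⁴ (tail f) ∙ g))
      ≈⟨ truncate (trans (U-⊞ _ _) (R.+-cong (U-scale (f 0) g) (U-X⁴∙ _))) ⟩
    const (f 0) ∙ U g ⊞ X ∙ U (ev X⁴ (tail f) ∙ g)
      ≈⟨ ⊞-below T.refl (∙-raise ≡.refl (go N (tail f))) ⟩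
    const (f 0) ∙ U g ⊞ X ∙ (tail f ∙ U g)
      ≈⟨ truncate (solve 4 (λ a x t u → a :* u :+ x :* (t :* u) := (a :+ x :* t) :* u) refl _ _ _ _) ⟩
    (const (f 0) ⊞ X ∙ tail f) ∙ U g
      ≈⟨ truncate (R.*-congʳ (unfold-X f)) ⟨
    f ∙ U g ∎
    where open T-Reasoning (suc N)

U-X : U X ≈ const 0ℤ
U-X = mk λ { zero → ≡.refl ; (suc n) → ≡.refl }

U-X² : U (X ↑ 2) ≈ const 0ℤ
U-X² = trans (U-cong (sym (q^≈X↑ 2))) (mk λ { zero → ≡.refl ; (suc n) → ≡.refl })

U-X³ : U (X ↑ 3) ≈ const 0ℤ
U-X³ = trans (U-cong (sym (q^≈X↑ 3))) (mk λ { zero → ≡.refl ; (suc n) → ≡.refl })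

-- Multiplication by q moves the index 4t + 3 to 4(t + 1), so the step keeps the coefficients with n
-- ≡ 3 (mod 4) and places them at t + 1.
step : PowerSeries → PowerSeries
step f = U (X ∙ f)

step-cong : ∀ {f g} → f ≈ g → step f ≈ step g
step-cong p = U-cong (R.*-congˡ p)

step-scale : ∀ a f → step (const a ∙ f) ≈ const a ∙ step f
step-scale a f = trans (U-cong (solve 3 (λ x a f → x :* (a :* f)
     := a :* (x :* f)) refl X (const a) f)) (U-scale a (X ∙ f))

tail⁴ : PowerSeries → PowerSeries
tail⁴ h n = h (4 ℕ.+ n)

-- U turns w·v^(3+4j) = 8·16ʲ·w^(4+4j) into 8W·8ʲ·(2W)ʲ: one factor 2 out of each 16 is absorbed by
-- 2W, and 8ʲ is left.
stretch : PowerSeries → PowerSeries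
stretch h j = (+ 8) ℤ.^ j ℤ.* h (3 ℕ.+ j ℕ.* 4)

tail-stretch : ∀ h → tail (stretch h) ≈ const (+ 8) ∙ stretch (tail⁴ h)
tail-stretch h = mk λ j → ≡.trans (ℤ.*-assoc (+ 8) ((+ 8) ℤ.^ j) _) (≡.sym (const-∙ (+ 8) (stretch (tail⁴ h)) j))

-- W and w of the header.
lower upper : PowerSeries → PowerSeries
lower A = X ∙ A ↑ 4
upper A = X ∙ ev X⁴ A

-- The descent: one step on Z times a series in v

module Descent
  (A Z k e : PowerSeries)
  (e0 : e 0 ≡ 0ℤ)
  (2W≈ : const (+ 2) ∙ lower A ≈ ev (const (+ 2) ∙ upper A) e)
  (X∙Z≈ : X ∙ Z ≈ ev X⁴ Z ∙ (upper A ∙ ev (const (+ 2) ∙ upper A) k))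
  (c : ℤ) (ke₃ : (k ∙ e) 3 ≡ + 2 ℤ.* c)
  where

  B w v W : PowerSeries
  B = ev X⁴ A
  w = upper A
  v = const (+ 2) ∙ w
  W = lower A

  v0 : v 0 ≡ 0ℤ
  v0 = ≡.trans (const-∙ (+ 2) w 0) (cong (+ 2 ℤ.*_) (X∙-zero _))

  W0 : W 0 ≡ 0ℤ
  W0 = X∙-zero _

  2W0 : (const (+ 2) ∙ W) 0 ≡ 0ℤ
  2W0 = ≡.trans (const-∙ (+ 2) W 0) (cong (+ 2 ℤ.*_) W0)

  w⁴≈ : w ↑ 4 ≈ ev X⁴ W
  w⁴≈ = begin
    w ↑ 4             ≈⟨ solve 2 (λ x b → (x :* b) :^ 4 := x :^ 4 :* b :^ 4) refl X B ⟩
    X⁴ ∙ B ↑ 4        ≈⟨ R.*-cong (ev-X X⁴-zero) (ev-↑ X⁴-zero A 4) ⟨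
    ev X⁴ X ∙ ev X⁴ (A ↑ 4) ≈⟨ ev-∙ X⁴-zero X (A ↑ 4) ⟨
    ev X⁴ W           ∎
    where open ≈-Reasoning

  -- What remains of a step once Z(q⁴) has left U: by `step-Z∙ev`, Z·h(v) goes to Z times `Q` of
  -- k·h.
  Q : PowerSeries → PowerSeries
  Q h = U (w ∙ ev v h)

  U-B∙ : ∀ n {g} → U g ≈ const 0ℤ → U (B ↑ n ∙ g) ≈ const 0ℤ
  U-B∙ n {g} Ug≈0 = begin
    U (B ↑ n ∙ g)          ≈⟨ U-cong (R.*-congʳ (ev-↑ X⁴-zero A n)) ⟨
    U (ev X⁴ (A ↑ n) ∙ g)  ≈⟨ U-ev (A ↑ n) g ⟩
    A ↑ n ∙ U g            ≈⟨ R.*-congˡ Ug≈0 ⟩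
    A ↑ n ∙ const 0ℤ       ≈⟨ R.zeroʳ _ ⟩
    const 0ℤ               ∎
    where open ≈-Reasoning

  U-scale-zero : ∀ a {g} → U g ≈ const 0ℤ → U (const a ∙ g) ≈ const 0ℤ
  U-scale-zero a {g} Ug≈0 = trans (U-scale a g) (trans (R.*-congˡ Ug≈0) (R.zeroʳ _))

  U-w⁴∙ : ∀ g → U (w ↑ 4 ∙ g) ≈ W ∙ U g
  U-w⁴∙ g = trans (U-cong (R.*-congʳ w⁴≈)) (U-ev W g)

  -- Of the expansion of h to order four in v = 2w, the first three terms die under U, the fourth
  -- gives w·v³ = 8w⁴, and the rest carries v⁴ = 16w⁴, which leaves U as 16W and reproduces a `Q`.
  Q-unfold : ∀ h → Q h ≈ const (+ 8) ∙ const (h 3) ∙ W ⊞ const (+ 16) ∙ W ∙ Q (tail⁴ h)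
  Q-unfold h = begin
    Q h
      ≈⟨ U-cong expand ⟩
    U (const (h 0) ∙ g₁ ⊞ (const (h 1) ∙ g₂ ⊞ (const (h 2) ∙ g₃ ⊞ (const (h 3) ∙ g₄ ⊞ g₅))))
      ≈⟨ trans (U-⊞ _ _) (R.+-cong (U-scale-zero (h 0) (U-B∙ 1 U-X))
        (trans (U-⊞ _ _) (R.+-cong (U-scale-zero (h 1) (U-scale-zero (+ 2) (U-B∙ 2 U-X²)))
        (trans (U-⊞ _ _) (R.+-cong (U-scale-zero (h 2) (U-scale-zero (+ 4) (U-B∙ 3 U-X³)))
        (trans (U-⊞ _ _) (R.+-cong (trans (U-scale (h 3) g₄) (R.*-congˡ (U-w⁴∙ _))) (U-w⁴∙ _)))))))) ⟩
    const 0ℤ ⊞ (const 0ℤ ⊞ (const 0ℤ ⊞ (const (h 3) ∙ (W ∙ U (const (+ 8) ∙ const 1ℤ))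
      ⊞ W ∙ U (const (+ 16) ∙ (w ∙ ev v (tail⁴ h))))))
      ≈⟨ R.+-congˡ (R.+-congˡ (R.+-congˡ (R.+-cong (R.*-congˡ (R.*-congˡ
           (trans (U-scale (+ 8) _) (R.*-congˡ (mk λ { zero → ≡.refl ; (suc n) → ≡.refl }))))) (R.*-congˡ (U-scale (+ 16) _))))) ⟩
    const 0ℤ ⊞ (const 0ℤ ⊞ (const 0ℤ ⊞ (const (h 3) ∙ (W ∙ (const (+ 8) ∙ const 1ℤ)) ⊞ W ∙ (const (+ 16) ∙ Q (tail⁴ h)))))
      ≈⟨ solve 3 (λ h W Q → con 0ℤ :+ (con 0ℤ :+ (con 0ℤ :+ (h :* (W :* (con (+ 8) :* con 1ℤ)) :+ W :* (con (+ 16) :* Q))))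
           := con (+ 8) :* h :* W :+ con (+ 16) :* W :* Q) refl (const (h 3)) W (Q (tail⁴ h)) ⟩
    const (+ 8) ∙ const (h 3) ∙ W ⊞ const (+ 16) ∙ W ∙ Q (tail⁴ h) ∎
    where
    open ≈-Reasoning
    g₁ = B ↑ 1 ∙ X
    g₂ = const (+ 2) ∙ (B ↑ 2 ∙ X ↑ 2)
    g₃ = const (+ 4) ∙ (B ↑ 3 ∙ X ↑ 3)
    g₄ = w ↑ 4 ∙ (const (+ 8) ∙ const 1ℤ)
    g₅ = w ↑ 4 ∙ (const (+ 16) ∙ (w ∙ ev v (tail⁴ h)))
    unfold₄ : ev v h ≈ const (h 0) ⊞ v ∙ (const (h 1) ⊞ v ∙ (const (h 2) ⊞ v ∙ (const (h 3) ⊞ v ∙ ev v (tail⁴ h))))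
    unfold₄ = trans (ev-unfold v0 h) (R.+-congˡ (R.*-congˡ
      (trans (ev-unfold v0 (tail h)) (R.+-congˡ (R.*-congˡ
      (trans (ev-unfold v0 (tail (tail h))) (R.+-congˡ (R.*-congˡ
      (ev-unfold v0 (tail (tail (tail h))))))))))))
    expand : w ∙ ev v h ≈ const (h 0) ∙ g₁ ⊞ (const (h 1) ∙ g₂ ⊞ (const (h 2) ∙ g₃ ⊞ (const (h 3) ∙ g₄ ⊞ g₅)))
    expand = trans (R.*-congˡ unfold₄)
      (solve 7 (λ x b a₀ a₁ a₂ a₃ t → let w = x :* b ; v = con (+ 2) :* w in
        w :* (a₀ :+ v :* (a₁ :+ v :* (a₂ :+ v :* (a₃ :+ v :* t)))) :=
        a₀ :* (b :^ 1 :* x) :+ (a₁ :* (con (+ 2) :* (b :^ 2 :* x :^ 2)) :+ (a₂ :* (con (+ 4) :* (b :^ 3 :* x :^ 3))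
          :+ (a₃ :* (w :^ 4 :* (con (+ 8) :* con 1ℤ)) :+ w :^ 4 :* (con (+ 16) :* (w :* t))))))
        refl X B _ _ _ _ _)

  -- Solves the recursion `Q-unfold`. Its factor W has no constant term, so each use gains one
  -- coefficient, and 16W = 8·2W matches `tail-stretch`.
  Q≈ : ∀ h → Q h ≈ W ∙ (const (+ 8) ∙ ev (const (+ 2) ∙ W) (stretch h))
  Q≈ h = limit λ N → go N h
    where
    go : ∀ N h → Q h ≈[ N ] W ∙ (const (+ 8) ∙ ev (const (+ 2) ∙ W) (stretch h))
    go zero    h = mk λ ()
    go (suc N) h = begin
      Q h
        ≈⟨ truncate (trans (Q-unfold h) (R.+-congˡ
             (solve 2 (λ W q → con (+ 16) :* W :* q := W :* (con (+ 16) :* q)) refl W (Q (tail⁴ h))))) ⟩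
      const (+ 8) ∙ const (h 3) ∙ W ⊞ W ∙ (const (+ 16) ∙ Q (tail⁴ h))
        ≈⟨ ⊞-below T.refl (∙-raise W0 (∙-below T.refl (go N (tail⁴ h)))) ⟩
      const (+ 8) ∙ const (h 3) ∙ W ⊞ W ∙ (const (+ 16) ∙ (W ∙ (const (+ 8) ∙ E)))
        ≈⟨ truncate (solve 3 (λ h W E → con (+ 8) :* h :* W :+ W :* (con (+ 16) :* (W :* (con (+ 8) :* E)))
             := W :* (con (+ 8) :* (h :+ con (+ 2) :* W :* (con (+ 8) :* E)))) refl (const (h 3)) W E) ⟩
      W ∙ (const (+ 8) ∙ (const (h 3) ⊞ const (+ 2) ∙ W ∙ (const (+ 8) ∙ E)))
        ≈⟨ truncate (R.*-congˡ (R.*-congˡ (R.+-cong (R.reflexive (cong const (ℤ.*-identityˡ (h 3))))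
             (R.*-congˡ (trans (ev-cong _ (tail-stretch h)) (ev-scale 2W0 (+ 8) _)))))) ⟨
      W ∙ (const (+ 8) ∙ (const (stretch h 0) ⊞ const (+ 2) ∙ W ∙ ev (const (+ 2) ∙ W) (tail (stretch h))))
        ≈⟨ truncate (R.*-congˡ (R.*-congˡ (ev-unfold 2W0 (stretch h)))) ⟨
      W ∙ (const (+ 8) ∙ ev (const (+ 2) ∙ W) (stretch h)) ∎
      where
      open T-Reasoning (suc N)
      E = ev (const (+ 2) ∙ W) (stretch (tail⁴ h))

  -- The recursion is unfolded once, to keep the coefficient of index 3 explicit. The rest is 16W·8W
  -- = 32(2W)² times a series in 2W, and substituting 2W = e(v) makes it a series in v, ready for
  -- the next step.
  Q-split : ∀ h → ∃ λ r → Q h ≈ const (+ 8) ∙ const (h 3) ∙ W ⊞ const (+ 32) ∙ ev v r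
  Q-split h = e ∙ e ∙ ev e s , (begin
    Q h
      ≈⟨ Q-unfold h ⟩
    const (+ 8) ∙ const (h 3) ∙ W ⊞ const (+ 16) ∙ W ∙ Q (tail⁴ h)
      ≈⟨ R.+-congˡ (trans (R.*-congˡ (Q≈ (tail⁴ h))) (solve 2
           (λ W t → con (+ 16) :* W :* (W :* (con (+ 8) :* t))
                := con (+ 32) :* (con (+ 2) :* W :* (con (+ 2) :* W) :* t))
           refl W _)) ⟩
    const (+ 8) ∙ const (h 3) ∙ W ⊞ const (+ 32) ∙ (const (+ 2) ∙ W ∙ (const (+ 2) ∙ W) ∙ ev (const (+ 2) ∙ W) s)
      ≈⟨ R.+-congˡ (R.*-congˡ (R.*-cong (R.*-cong 2W≈ 2W≈) (ev-congˡ s 2W≈))) ⟩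
    const (+ 8) ∙ const (h 3) ∙ W ⊞ const (+ 32) ∙ (ev v e ∙ ev v e ∙ ev (ev v e) s)
      ≈⟨ R.+-congˡ (R.*-congˡ (trans (ev-∙ v0 _ _) (R.*-cong (ev-∙ v0 e e) (ev-ev v0 e0 s)))) ⟨
    const (+ 8) ∙ const (h 3) ∙ W ⊞ const (+ 32) ∙ ev v (e ∙ e ∙ ev e s) ∎)
    where
    open ≈-Reasoning
    s = stretch (tail⁴ h)

  step-Z∙ev : ∀ h → step (Z ∙ ev v h) ≈ Z ∙ Q (k ∙ h)
  step-Z∙ev h = begin
    U (X ∙ (Z ∙ ev v h))
      ≈⟨ U-cong (trans (sym (R.*-assoc X Z _)) (R.*-congʳ X∙Z≈)) ⟩
    U (ev X⁴ Z ∙ (w ∙ ev v k) ∙ ev v h)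
      ≈⟨ U-cong (solve 4 (λ z w k h → z :* (w :* k) :* h := z :* (w :* (k :* h))) refl _ _ _ _) ⟩
    U (ev X⁴ Z ∙ (w ∙ (ev v k ∙ ev v h)))
      ≈⟨ U-cong (R.*-congˡ (R.*-congˡ (ev-∙ v0 k h))) ⟨
    U (ev X⁴ Z ∙ (w ∙ ev v (k ∙ h)))
      ≈⟨ U-ev Z _ ⟩
    Z ∙ Q (k ∙ h) ∎
    where open ≈-Reasoning

  -- As 2W = e(v), these are the series m·Z·h(v) with h congruent to an integer multiple of e modulo
  -- 4.
  Divisible : ℤ → PowerSeries → Set
  Divisible m f = ∃₂ λ a g → f ≈ const m ∙ (Z ∙ (const a ∙ (const (+ 2) ∙ W) ⊞ const (+ 4) ∙ ev v g))

  Divisible-resp : ∀ {m f f′} → f ≈ f′ → Divisible m f → Divisible m f′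
  Divisible-resp f≈f′ (a , g , f≈) = a , g , trans (sym f≈f′) f≈

  Divisible-step : ∀ {m f} → Divisible m f → Divisible (m ℤ.* + 8) (step f)
  Divisible-step {m} {f} (a , g , f≈) = a′ , r , (begin
    step f
      ≈⟨ trans (step-cong f≈) (step-scale m _) ⟩
    const m ∙ step (Z ∙ (const a ∙ (const (+ 2) ∙ W) ⊞ const (+ 4) ∙ ev v g))
      ≈⟨ R.*-congˡ (step-cong (R.*-congˡ (trans (ev-⊞ v0 _ _) (R.+-cong
           (trans (ev-scale v0 a e) (R.*-congˡ (sym 2W≈))) (ev-scale v0 (+ 4) g))))) ⟨
    const m ∙ step (Z ∙ ev v h)
      ≈⟨ R.*-congˡ (trans (step-Z∙ev h) (R.*-congˡ Qkh≈)) ⟩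
    const m ∙ (Z ∙ (const (+ 8) ∙ const ((k ∙ h) 3) ∙ W ⊞ const (+ 32) ∙ ev v r))
      ≈⟨ R.*-congˡ (R.*-congˡ (R.+-congʳ (R.*-congʳ (R.*-congˡ
           (trans (R.reflexive (cong const kh₃)) (const-* (+ 2) a′)))))) ⟩
    const m ∙ (Z ∙ (const (+ 8) ∙ (const (+ 2) ∙ const a′) ∙ W ⊞ const (+ 32) ∙ ev v r))
      ≈⟨ solve 5 (λ m Z a W r → m :* (Z :* (con (+ 8) :* (con (+ 2) :* a) :* W :+ con (+ 32) :* r))
           := m :* con (+ 8) :* (Z :* (a :* (con (+ 2) :* W) :+ con (+ 4) :* r))) refl _ Z _ W _ ⟩
    const m ∙ const (+ 8) ∙ (Z ∙ (const a′ ∙ (const (+ 2) ∙ W) ⊞ const (+ 4) ∙ ev v r))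
      ≈⟨ R.*-congʳ (const-* m (+ 8)) ⟨
    const (m ℤ.* + 8) ∙ (Z ∙ (const a′ ∙ (const (+ 2) ∙ W) ⊞ const (+ 4) ∙ ev v r)) ∎)
    where
    open ≈-Reasoning
    h = const a ∙ e ⊞ const (+ 4) ∙ g
    -- Half of (kh)₃: by `ke₃` the multiple of e contributes an even amount, and so does 4g. Hence
    -- 8(kh)₃W = 8·a′·2W, with no loss.
    a′ = a ℤ.* c ℤ.+ + 2 ℤ.* (k ∙ g) 3
    r = proj₁ (Q-split (k ∙ h))
    Qkh≈ = proj₂ (Q-split (k ∙ h))
    ring : ∀ a c x → a ℤ.* (+ 2 ℤ.* c) ℤ.+ + 4 ℤ.* x ≡ + 2 ℤ.* (a ℤ.* c ℤ.+ + 2 ℤ.* x)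
    ring = ℤSolver.solve-∀
    kh₃ : (k ∙ h) 3 ≡ + 2 ℤ.* a′
    kh₃ = ≡.trans
      (at (solve 5 (λ k a e b g → k :* (a :* e :+ b :* g)
           := a :* (k :* e) :+ b :* (k :* g)) refl k (const a) e (const (+ 4)) g) 3)
      (≡.trans (⊞-at _ _ 3) (≡.trans (cong₂ ℤ._+_
        (≡.trans (const-∙ a (k ∙ e) 3) (cong (a ℤ.*_) ke₃)) (const-∙ (+ 4) (k ∙ g) 3))
        (ring a c ((k ∙ g) 3))))

  -- Nothing is assumed about the parity of (kh)₃ here, so this step yields only 4 in place of 8;
  -- `Divisible⇒∣` returns the missing 2, once for the whole iteration.
  Divisible-start : ∀ h → Divisible (+ 4) (step (Z ∙ ev v h))
  Divisible-start h = (k ∙ h) 3 , const (+ 2) ∙ r , (begin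
    step (Z ∙ ev v h)
      ≈⟨ trans (step-Z∙ev h) (R.*-congˡ Qkh≈) ⟩
    Z ∙ (const (+ 8) ∙ const ((k ∙ h) 3) ∙ W ⊞ const (+ 32) ∙ ev v r)
      ≈⟨ solve 4 (λ Z a W r → Z :* (con (+ 8) :* a :* W :+ con (+ 32) :* r)
           := con (+ 4) :* (Z :* (a :* (con (+ 2) :* W) :+ con (+ 4) :* (con (+ 2) :* r)))) refl Z _ W _ ⟩
    const (+ 4) ∙ (Z ∙ (const ((k ∙ h) 3) ∙ (const (+ 2) ∙ W) ⊞ const (+ 4) ∙ (const (+ 2) ∙ ev v r)))
      ≈⟨ R.*-congˡ (R.*-congˡ (R.+-congˡ (R.*-congˡ (ev-scale v0 (+ 2) r)))) ⟨
    const (+ 4) ∙ (Z ∙ (const ((k ∙ h) 3) ∙ (const (+ 2) ∙ W) ⊞ const (+ 4) ∙ ev v (const (+ 2) ∙ r))) ∎)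
    where
    open ≈-Reasoning
    r = proj₁ (Q-split (k ∙ h))
    Qkh≈ = proj₂ (Q-split (k ∙ h))

  Divisible⇒∣ : ∀ {m f} → Divisible m f → ∀ n → m ℤ.* + 2 ∣ f n
  Divisible⇒∣ {m} {f} (a , g , f≈) n = divides (F n) (≡.trans (at f≈′ n)
    (≡.trans (const-∙ (m ℤ.* + 2) F n) (ℤ.*-comm (m ℤ.* + 2) (F n))))
    where
    F = Z ∙ (const a ∙ W ⊞ const (+ 2) ∙ ev v g)
    f≈′ : f ≈ const (m ℤ.* + 2) ∙ F
    f≈′ = trans f≈ (trans (solve 5
      (λ m Z a W r → m :* (Z :* (a :* (con (+ 2) :* W) :+ con (+ 4) :* r))
           := m :* con (+ 2) :* (Z :* (a :* W :+ con (+ 2) :* r)))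
      refl (const m) Z (const a) W (ev v g)) (R.*-congʳ (sym (const-* m (+ 2)))))

-- Products and theta series

∏ : (ℕ → PowerSeries) → ℕ → PowerSeries
∏ F zero    = const 1ℤ
∏ F (suc N) = F N ∙ ∏ F N

∏-cong : ∀ {F G} → (∀ i → F i ≈ G i) → ∀ N → ∏ F N ≈ ∏ G N
∏-cong p zero    = refl
∏-cong p (suc N) = R.*-cong (p N) (∏-cong p N)

∏-∙ : ∀ F G N → ∏ (λ i → F i ∙ G i) N ≈ ∏ F N ∙ ∏ G N
∏-∙ F G zero    = sym (R.*-identityˡ _)
∏-∙ F G (suc N) = trans (R.*-congˡ (∏-∙ F G N))
  (solve 4 (λ a b c d → a :* b :* (c :* d) := a :* c :* (b :* d)) refl (F N) (G N) _ _)

∏-↑ : ∀ F k N → ∏ (λ i → F i ↑ k) N ≈ ∏ F N ↑ k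
∏-↑ F zero    zero    = refl
∏-↑ F zero    (suc N) = trans (R.*-identityˡ _) (∏-↑ F zero N)
∏-↑ F (suc k) N       = trans (∏-∙ F (λ i → F i ↑ k) N) (R.*-congˡ (∏-↑ F k N))

-- The coefficient of qⁿ is read off the first n factors. Under `Converges` a factor of index i ≥ n
-- is 1 + O(qⁿ⁺¹) and cannot change it.
∏^∞ : (ℕ → PowerSeries) → PowerSeries
∏^∞ F n = ∏ F n n

Converges : (ℕ → PowerSeries) → Set
Converges F = ∀ i → F i ≈[ suc i ] const 1ℤ

∏^∞-below : ∀ {F} → Converges F → ∀ N → ∏^∞ F ≈[ suc N ] ∏ F N
∏^∞-below {F} conv N = mk λ { (s≤s n≤N) → go (ℕ.≤⇒≤′ n≤N) }
  where
  go : ∀ {n N} → n ℕ.≤′ N → ∏ F n n ≡ ∏ F N n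
  go ℕ.≤′-refl = ≡.refl
  go {n} {suc N} (ℕ.≤′-step p) = ≡.trans (go p) (≡.sym (below
    (T.trans (∙-below (conv N) T.refl) (truncate (R.*-identityˡ (∏ F N)))) (s≤s (ℕ.≤′⇒≤ p))))

X↑-below : ∀ n → X ↑ n ≈[ n ] const 0ℤ
X↑-below zero    = mk λ ()
X↑-below (suc n) = T.trans (∙-raise ≡.refl (X↑-below n)) (truncate (R.zeroʳ X))

∙-absorb : ∀ {N f} g → f ≈[ N ] const 0ℤ → f ∙ g ≈[ N ] const 0ℤ
∙-absorb g p = T.trans (∙-below p T.refl) (truncate (R.zeroˡ g))

1-small : ∀ {N f} → f ≈[ N ] const 0ℤ → const 1ℤ - f ≈[ N ] const 1ℤ
1-small {f = f} p = T.trans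
  (truncate (solve 1 (λ f → con 1ℤ :- f := con 1ℤ :+ con (ℤ.- 1ℤ) :* f) refl f))
  (T.trans (⊞-below T.refl (∙-below (T.refl {x = const (ℤ.- 1ℤ)}) p))
    (truncate (solve 0 (con 1ℤ :+ con (ℤ.- 1ℤ) :* con 0ℤ := con 1ℤ) refl)))

eulerFactor oddFactor plusFactor : PowerSeries → ℕ → PowerSeries
eulerFactor x i = const 1ℤ - x ↑ suc i
oddFactor   x i = const 1ℤ - x ↑ suc (i ℕ.* 2)
plusFactor  x i = const 1ℤ ⊞ x ↑ suc i

ev-1-↑ : ∀ {y} → y 0 ≡ 0ℤ → ∀ x n → ev y (const 1ℤ - x ↑ n) ≈ const 1ℤ - ev y x ↑ n
ev-1-↑ y0 x n = trans (ev-⊞ y0 _ _) (R.+-cong (ev-const y0 1ℤ)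
  (trans (ev-⊟ y0 _) (R.-‿cong (ev-↑ y0 x n))))

ev-∏ : ∀ {y} → y 0 ≡ 0ℤ → ∀ {F G} → (∀ i → ev y (F i) ≈ G i) → ∀ N → ev y (∏ F N) ≈ ∏ G N
ev-∏ y0 p zero    = ev-const y0 1ℤ
ev-∏ y0 p (suc N) = trans (ev-∙ y0 _ _) (R.*-cong (p N) (ev-∏ y0 p N))

ev-euler : ∀ {y} → y 0 ≡ 0ℤ → ∀ N → ev y (∏ (eulerFactor X) N) ≈ ∏ (eulerFactor y) N
ev-euler y0 = ev-∏ y0 λ i → trans (ev-1-↑ y0 X (suc i)) (R.+-congˡ (R.-‿cong (↑-cong (suc i) (ev-X y0))))

ev-odd : ∀ {y} → y 0 ≡ 0ℤ → ∀ N → ev y (∏ (oddFactor X) N) ≈ ∏ (oddFactor y) N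
ev-odd y0 = ev-∏ y0 λ i → trans (ev-1-↑ y0 X (suc (i ℕ.* 2)))
  (R.+-congˡ (R.-‿cong (↑-cong (suc (i ℕ.* 2)) (ev-X y0))))

↑-double : ∀ x i → (x ↑ 2) ↑ i ≈ x ↑ (i ℕ.* 2)
↑-double x i = trans (↑-assoc x 2 i) (R.reflexive (cong (x ↑_) (ℕ.*-comm 2 i)))

euler-split : ∀ x N → ∏ (eulerFactor x) (N ℕ.* 2) ≈ ∏ (eulerFactor (x ↑ 2)) N ∙ ∏ (oddFactor x) N
euler-split x zero    = sym (R.*-identityˡ _)
euler-split x (suc N) = begin
  (const 1ℤ - x ↑ (suc N ℕ.* 2)) ∙ (oddFactor x N ∙ ∏ (eulerFactor x) (N ℕ.* 2))
    ≈⟨ R.*-cong (R.+-congˡ (R.-‿cong (sym (↑-double x (suc N))))) (R.*-congˡ (euler-split x N)) ⟩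
  eulerFactor (x ↑ 2) N ∙ (oddFactor x N ∙ (∏ (eulerFactor (x ↑ 2)) N ∙ ∏ (oddFactor x) N))
    ≈⟨ solve 4 (λ a b c d → a :* (b :* (c :* d)) := a :* c :* (b :* d)) refl _ _ _ _ ⟩
  ∏ (eulerFactor (x ↑ 2)) (suc N) ∙ ∏ (oddFactor x) (suc N) ∎
  where open ≈-Reasoning

⊟-↑-double : ∀ x i → (⊟ x) ↑ (i ℕ.* 2) ≈ x ↑ (i ℕ.* 2)
⊟-↑-double x i = trans (sym (↑-double (⊟ x) i)) (trans
  (↑-cong i (solve 1 (λ x → (:- x) :^ 2 := x :^ 2) refl x)) (↑-double x i))

odd-conjugate : ∀ x N → ∏ (oddFactor x) N ∙ ∏ (oddFactor (⊟ x)) N ≈ ∏ (oddFactor (x ↑ 2)) N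
odd-conjugate x N = trans (sym (∏-∙ _ _ N)) (∏-cong factor≈ N)
  where
  open ≈-Reasoning
  factor≈ : ∀ i → oddFactor x i ∙ oddFactor (⊟ x) i ≈ oddFactor (x ↑ 2) i
  factor≈ i = begin
    oddFactor x i ∙ (const 1ℤ - (⊟ x) ∙ (⊟ x) ↑ (i ℕ.* 2))
      ≈⟨ R.*-congˡ (R.+-congˡ (R.-‿cong (R.*-congˡ (⊟-↑-double x i)))) ⟩
    oddFactor x i ∙ (const 1ℤ - (⊟ x) ∙ x ↑ (i ℕ.* 2))
      ≈⟨ solve 2 (λ x z → (con 1ℤ :- x :* z) :* (con 1ℤ :- (:- x) :* z)
           := con 1ℤ :- (x :* z) :^ 2) refl x (x ↑ (i ℕ.* 2)) ⟩
    const 1ℤ - (x ↑ suc (i ℕ.* 2)) ↑ 2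
      ≈⟨ R.+-congˡ (R.-‿cong (trans (↑-assoc x (suc (i ℕ.* 2)) 2)
           (trans (R.reflexive (cong (x ↑_) (ℕ.*-comm (suc (i ℕ.* 2)) 2))) (sym (↑-assoc x 2 (suc (i ℕ.* 2))))))) ⟩
    oddFactor (x ↑ 2) i ∎

euler-plus : ∀ x N → ∏ (plusFactor x) N ∙ ∏ (eulerFactor x) N ≈ ∏ (eulerFactor (x ↑ 2)) N
euler-plus x N = trans (sym (∏-∙ _ _ N)) (∏-cong (λ i → trans
  (solve 1 (λ z → (con 1ℤ :+ z) :* (con 1ℤ :- z) := con 1ℤ :- z :^ 2) refl (x ↑ suc i))
  (R.+-congˡ (R.-‿cong (trans (↑-assoc x (suc i) 2)
    (trans (R.reflexive (cong (x ↑_) (ℕ.*-comm (suc i) 2))) (sym (↑-assoc x 2 (suc i)))))))) N)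

-- Finite forms, due to D. Shanks, of Gauss's theorems on Σ (−1)ⁿ q^(n²) and
-- Σ q^(n(n+1)/2). Shanks's sum is Y (x^(n+1)) n, respectively Y (x^(2n+1)) n; with
-- z free and s independent of n, his telescoping becomes an induction on s.

module Squares (x : PowerSeries) where

  A B : ℕ → PowerSeries
  A = ∏ (eulerFactor x)
  B = ∏ (plusFactor x)

  S : ℕ → PowerSeries
  S zero    = const 1ℤ
  S (suc n) = S n ⊞ const (+ 2) ∙ (⊟ (x ↑ suc n)) ↑ suc n

  Y : PowerSeries → ℕ → PowerSeries
  Y z zero    = const 1ℤ
  Y z (suc s) = Y z s ∙ eulerFactor x s ⊞ const (+ 2) ∙ (⊟ z) ↑ suc s ∙ B s

  Y-cong : ∀ {z z′} → z ≈ z′ → ∀ s → Y z s ≈ Y z′ s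
  Y-cong p zero    = refl
  Y-cong p (suc s) = R.+-cong (R.*-congʳ (Y-cong p s)) (R.*-congʳ (R.*-congˡ (↑-cong (suc s) (R.-‿cong p))))

  -- Both sides gain the Euler factor 1 - x^(m+1); the leftover terms combine because `B (suc m)` is
  -- (1 + x^(m+1))·`B m`.
  Y-recurrence : ∀ z m → (const 1ℤ - z) ∙ Y (x ∙ z) m ≈ (const 1ℤ ⊞ z) ∙ Y z m ⊞ const (+ 2) ∙ (⊟ z) ↑ suc m ∙ B m
  Y-recurrence z zero = solve 1 (λ z → (con 1ℤ :- z) :* con 1ℤ
       := (con 1ℤ :+ z) :* con 1ℤ :+ con (+ 2) :* ((:- z) :* con 1ℤ) :* con 1ℤ) refl z
  Y-recurrence z (suc m) = begin
    (const 1ℤ - z) ∙ (Y (x ∙ z) m ∙ (const 1ℤ - p) ⊞ const (+ 2) ∙ (⊟ (x ∙ z)) ↑ suc m ∙ B m)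
      ≈⟨ R.*-congˡ (R.+-congˡ (R.*-congʳ (R.*-congˡ (trans
           (↑-cong (suc m) (solve 2 (λ x z → :- (x :* z) := x :* (:- z)) refl x z)) (∙-↑ x (⊟ z) (suc m)))))) ⟩
    (const 1ℤ - z) ∙ (Y (x ∙ z) m ∙ (const 1ℤ - p) ⊞ const (+ 2) ∙ (p ∙ u) ∙ B m)
      ≈⟨ solve 5 (λ z Y p u B → (con 1ℤ :- z) :* (Y :* (con 1ℤ :- p) :+ con (+ 2) :* (p :* u) :* B)
           := (con 1ℤ :- z) :* Y :* (con 1ℤ :- p) :+ (con 1ℤ :- z) :* (con (+ 2) :* (p :* u) :* B)) refl z _ p u (B m) ⟩
    (const 1ℤ - z) ∙ Y (x ∙ z) m ∙ (const 1ℤ - p) ⊞ (const 1ℤ - z) ∙ (const (+ 2) ∙ (p ∙ u) ∙ B m)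
      ≈⟨ R.+-congʳ (R.*-congʳ (Y-recurrence z m)) ⟩
    ((const 1ℤ ⊞ z) ∙ Y z m ⊞ const (+ 2) ∙ u ∙ B m) ∙ (const 1ℤ - p) ⊞ (const 1ℤ - z) ∙ (const (+ 2) ∙ (p ∙ u) ∙ B m)
      ≈⟨ solve 5 (λ z Y p u B →
           ((con 1ℤ :+ z) :* Y :+ con (+ 2) :* u :* B) :* (con 1ℤ :- p) :+ (con 1ℤ :- z) :* (con (+ 2) :* (p :* u) :* B)
           := (con 1ℤ :+ z) :* (Y :* (con 1ℤ :- p) :+ con (+ 2) :* u :* B)
              :+ con (+ 2) :* ((:- z) :* u) :* ((con 1ℤ :+ p) :* B)) refl z (Y z m) p u (B m) ⟩
    (const 1ℤ ⊞ z) ∙ Y z (suc m) ⊞ const (+ 2) ∙ (⊟ z) ↑ suc (suc m) ∙ B (suc m) ∎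
    where
    open ≈-Reasoning
    p = x ↑ suc m
    u = (⊟ z) ↑ suc m

  -- At z = x^(n+1) the factor 1 - z of the recurrence is exactly the Euler factor that `Y` gains
  -- from n to n + 1, and 1 + z is the one that `B` gains.
  Y≈B∙S : ∀ n → Y (x ↑ suc n) n ≈ B n ∙ S n
  Y≈B∙S zero    = sym (R.*-identityˡ _)
  Y≈B∙S (suc n) = begin
    Y (x ∙ z) n ∙ (const 1ℤ - z) ⊞ const (+ 2) ∙ (⊟ (x ∙ z)) ↑ suc n ∙ B n
      ≈⟨ R.+-cong (trans (R.*-comm _ _) (Y-recurrence z n)) (R.*-congʳ (R.*-congˡ (trans
           (↑-cong (suc n) (solve 2 (λ x z → :- (x :* z) := x :* (:- z)) refl x z)) (∙-↑ x (⊟ z) (suc n))))) ⟩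
    (const 1ℤ ⊞ z) ∙ Y z n ⊞ const (+ 2) ∙ u ∙ B n ⊞ const (+ 2) ∙ (z ∙ u) ∙ B n
      ≈⟨ R.+-congʳ (R.+-congʳ (R.*-congˡ (Y≈B∙S n))) ⟩
    (const 1ℤ ⊞ z) ∙ (B n ∙ S n) ⊞ const (+ 2) ∙ u ∙ B n ⊞ const (+ 2) ∙ (z ∙ u) ∙ B n
      ≈⟨ solve 4 (λ z u B S → (con 1ℤ :+ z) :* (B :* S) :+ con (+ 2) :* u :* B :+ con (+ 2) :* (z :* u) :* B
           := (con 1ℤ :+ z) :* B :* (S :+ con (+ 2) :* u)) refl z u (B n) (S n) ⟩
    B (suc n) ∙ S (suc n) ∎
    where
    open ≈-Reasoning
    z = x ↑ suc n
    u = (⊟ z) ↑ suc n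

  -- Every term beyond the Euler product carries a factor z. With `Y≈B∙S` this makes the product
  -- `B`·`S` congruent to `A` to the order of z.
  Y-below : ∀ {N z} → z ≈[ N ] const 0ℤ → ∀ s → Y z s ≈[ N ] A s
  Y-below p zero    = T.refl
  Y-below {N} {z} p (suc s) = T.trans (⊞-below (∙-below (Y-below p s) (T.refl {x = eulerFactor x s}))
    (T.trans (truncate (solve 3 (λ z u b → con (+ 2) :* ((:- z) :* u) :* b
         := z :* (con (ℤ.- (+ 2)) :* u :* b)) refl z ((⊟ z) ↑ s) (B s)))
             (∙-absorb _ p)))
    (truncate (solve 2 (λ a e → a :* e :+ con 0ℤ := e :* a) refl (A s) (eulerFactor x s)))

module Triangles (x : PowerSeries) where

  A B : ℕ → PowerSeries
  A = ∏ (eulerFactor (x ↑ 2))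
  B = ∏ (oddFactor x)

  -- Two triangular exponents at a time: (2n + 1)(n + 1) and (2n + 3)(n + 1) are the triangular
  -- numbers of index 2n + 1 and 2n + 2.
  S : ℕ → PowerSeries
  S zero    = const 1ℤ
  S (suc n) = S n ⊞ (x ↑ suc (n ℕ.* 2)) ↑ suc n ⊞ (x ↑ suc (suc n ℕ.* 2)) ↑ suc n

  Y : PowerSeries → ℕ → PowerSeries
  Y z zero    = const 1ℤ
  Y z (suc s) = Y z s ∙ eulerFactor (x ↑ 2) s ⊞ B (suc s) ∙ z ↑ suc s

  Y-recurrence : ∀ z m → (const 1ℤ - x ∙ z) ∙ Y (x ∙ (x ∙ z)) m ≈ (const 1ℤ - z) ∙ Y z m ⊞ B (suc m) ∙ z ↑ suc m
  Y-recurrence z zero = solve 2 (λ x z → (con 1ℤ :- x :* z) :* con 1ℤ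
    := (con 1ℤ :- z) :* con 1ℤ :+ (con 1ℤ :- x :* con 1ℤ) :* con 1ℤ :* (z :* con 1ℤ)) refl x z
  Y-recurrence z (suc m) = begin
    (const 1ℤ - x ∙ z) ∙ (Y z″ m ∙ (const 1ℤ - p) ⊞ b ∙ z″ ↑ suc m)
      ≈⟨ R.*-congˡ (R.+-congˡ (R.*-congˡ (trans
           (↑-cong (suc m) (solve 2 (λ x z → x :* (x :* z)
                := x :^ 2 :* z) refl x z)) (∙-↑ (x ↑ 2) z (suc m))))) ⟩
    (const 1ℤ - x ∙ z) ∙ (Y z″ m ∙ (const 1ℤ - p) ⊞ b ∙ (p ∙ u))
      ≈⟨ solve 6 (λ x z Y p u b → (con 1ℤ :- x :* z) :* (Y :* (con 1ℤ :- p) :+ b :* (p :* u))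
           := (con 1ℤ :- x :* z) :* Y :* (con 1ℤ :- p) :+ (con 1ℤ :- x :* z) :* (b :* (p :* u))) refl x z _ p u b ⟩
    (const 1ℤ - x ∙ z) ∙ Y z″ m ∙ (const 1ℤ - p) ⊞ (const 1ℤ - x ∙ z) ∙ (b ∙ (p ∙ u))
      ≈⟨ R.+-congʳ (R.*-congʳ (Y-recurrence z m)) ⟩
    ((const 1ℤ - z) ∙ Y z m ⊞ b ∙ u) ∙ (const 1ℤ - p) ⊞ (const 1ℤ - x ∙ z) ∙ (b ∙ (p ∙ u))
      ≈⟨ solve 6 (λ x z Y p u b → ((con 1ℤ :- z) :* Y :+ b :* u) :* (con 1ℤ :- p) :+ (con 1ℤ :- x :* z) :* (b :* (p :* u))
           := (con 1ℤ :- z) :* (Y :* (con 1ℤ :- p) :+ b :* u) :+ (con 1ℤ :- x :* p) :* b :* (z :* u)) refl x z (Y z m) p u b ⟩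
    (const 1ℤ - z) ∙ Y z (suc m) ⊞ (const 1ℤ - x ∙ p) ∙ b ∙ z ↑ suc (suc m)
      ≈⟨ R.+-congˡ (R.*-congʳ (R.*-congʳ (R.+-congˡ (R.-‿cong (R.*-congˡ (↑-double x (suc m))))))) ⟩
    (const 1ℤ - z) ∙ Y z (suc m) ⊞ B (suc (suc m)) ∙ z ↑ suc (suc m) ∎
    where
    open ≈-Reasoning
    z″ = x ∙ (x ∙ z)
    p = (x ↑ 2) ↑ suc m
    u = z ↑ suc m
    b = B (suc m)

  -- At z = x^(2n+1) the new factor of `Y` is 1 - (x²)^(n+1) = 1 - xz, as the recurrence wants, and
  -- 1 - z is the new factor of `B`.
  Y≈B∙S : ∀ n → Y (x ↑ suc (n ℕ.* 2)) n ≈ B n ∙ S n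
  Y≈B∙S zero    = sym (R.*-identityˡ _)
  Y≈B∙S (suc n) = begin
    Y z″ n ∙ (const 1ℤ - (x ↑ 2) ↑ suc n) ⊞ B (suc n) ∙ z″ ↑ suc n
      ≈⟨ R.+-congʳ (trans (R.*-congˡ (R.+-congˡ (R.-‿cong (↑-double x (suc n)))))
           (trans (R.*-comm _ _) (Y-recurrence z n))) ⟩
    (const 1ℤ - z) ∙ Y z n ⊞ B (suc n) ∙ z ↑ suc n ⊞ B (suc n) ∙ z″ ↑ suc n
      ≈⟨ R.+-congʳ (R.+-congʳ (R.*-congˡ (Y≈B∙S n))) ⟩
    (const 1ℤ - z) ∙ (B n ∙ S n) ⊞ B (suc n) ∙ z ↑ suc n ⊞ B (suc n) ∙ z″ ↑ suc n
      ≈⟨ solve 5 (λ z B S u v → (con 1ℤ :- z) :* (B :* S) :+ (con 1ℤ :- z) :* B :* u :+ (con 1ℤ :- z) :* B :* v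
           := (con 1ℤ :- z) :* B :* (S :+ u :+ v)) refl z (B n) (S n) _ _ ⟩
    B (suc n) ∙ S (suc n) ∎
    where
    open ≈-Reasoning
    z = x ↑ suc (n ℕ.* 2)
    z″ = x ∙ (x ∙ z)

  Y-below : ∀ {N z} → z ≈[ N ] const 0ℤ → ∀ s → Y z s ≈[ N ] A s
  Y-below p zero    = T.refl
  Y-below {N} {z} p (suc s) = T.trans (⊞-below (∙-below (Y-below p s) (T.refl {x = eulerFactor (x ↑ 2) s}))
    (T.trans (truncate (solve 3 (λ z u b → b :* (z :* u) := z :* (b :* u)) refl z (z ↑ s) (B (suc s))))
             (∙-absorb _ p)))
    (truncate (solve 2 (λ a e → a :* e :+ con 0ℤ := e :* a) refl (A s) (eulerFactor (x ↑ 2) s)))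

squareSum : PowerSeries → ℕ → PowerSeries
squareSum x zero    = const 1ℤ
squareSum x (suc n) = squareSum x n ⊞ const (+ 2) ∙ x ↑ (suc n ℕ.* suc n)

triangle : ℕ → ℕ
triangle zero    = zero
triangle (suc n) = suc n ℕ.+ triangle n

triangleSum : PowerSeries → ℕ → PowerSeries
triangleSum x zero    = const 1ℤ
triangleSum x (suc n) = triangleSum x n ⊞ x ↑ triangle (suc n)

triangle-double : ∀ n → triangle n ℕ.* 2 ≡ n ℕ.* suc n
triangle-double zero    = ≡.refl
triangle-double (suc n) = ≡.trans (ℕ.*-distribʳ-+ 2 (suc n) (triangle n))
  (≡.trans (cong (λ t → suc n ℕ.* 2 ℕ.+ t) (triangle-double n)) (ring n))
  where
  ring : ∀ n → suc n ℕ.* 2 ℕ.+ n ℕ.* suc n ≡ suc n ℕ.* suc (suc n)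
  ring = ℕSolver.solve-∀

square-even : ∀ n → (n ℕ.* 2) ℕ.* (n ℕ.* 2) ≡ 4 ℕ.* (n ℕ.* n)
square-even = ℕSolver.solve-∀

square-odd : ∀ n → suc (n ℕ.* 2) ℕ.* suc (n ℕ.* 2) ≡ suc (8 ℕ.* triangle n)
square-odd n = begin
  suc (n ℕ.* 2) ℕ.* suc (n ℕ.* 2)      ≡⟨ ring₁ n ⟩
  suc (4 ℕ.* (n ℕ.* suc n))            ≡⟨ cong (λ t → suc (4 ℕ.* t)) (triangle-double n) ⟨
  suc (4 ℕ.* (triangle n ℕ.* 2))       ≡⟨ ring₂ (triangle n) ⟩
  suc (8 ℕ.* triangle n)               ∎
  where
  open ≡.≡-Reasoning
  ring₁ : ∀ n → suc (n ℕ.* 2) ℕ.* suc (n ℕ.* 2) ≡ suc (4 ℕ.* (n ℕ.* suc n))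
  ring₁ = ℕSolver.solve-∀
  ring₂ : ∀ t → suc (4 ℕ.* (t ℕ.* 2)) ≡ suc (8 ℕ.* t)
  ring₂ = ℕSolver.solve-∀

-- Squares sorted by parity: (2n)² = 4n², and (2n + 1)² is 1 plus 8 times the n-th triangular
-- number.
squareSum-split : ∀ x N → squareSum x (suc (N ℕ.* 2)) ≈
  squareSum (x ↑ 4) N ⊞ const (+ 2) ∙ (x ∙ triangleSum (x ↑ 8) N)
squareSum-split x zero    = solve 1 (λ x → con 1ℤ :+ con (+ 2) :* (x :* con 1ℤ)
     := con 1ℤ :+ con (+ 2) :* (x :* con 1ℤ)) refl x
squareSum-split x (suc N) = begin
  squareSum x (suc (N ℕ.* 2)) ⊞ const (+ 2) ∙ x ↑ (suc N ℕ.* 2 ℕ.* (suc N ℕ.* 2))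
    ⊞ const (+ 2) ∙ x ↑ (suc (suc N ℕ.* 2) ℕ.* suc (suc N ℕ.* 2))
    ≈⟨ R.+-cong (R.+-cong (squareSum-split x N)
         (R.*-congˡ (trans (R.reflexive (cong (x ↑_) (square-even (suc N)))) (sym (↑-assoc x 4 (suc N ℕ.* suc N))))))
         (R.*-congˡ (trans (R.reflexive (cong (x ↑_) (square-odd (suc N)))) (R.*-congˡ
           (sym (↑-assoc x 8 (triangle (suc N))))))) ⟩
  squareSum (x ↑ 4) N ⊞ const (+ 2) ∙ (x ∙ triangleSum (x ↑ 8) N) ⊞ const (+ 2) ∙ (x ↑ 4) ↑ (suc N ℕ.* suc N)
    ⊞ const (+ 2) ∙ (x ∙ (x ↑ 8) ↑ triangle (suc N))
    ≈⟨ solve 5 (λ x s t a b → s :+ con (+ 2) :* (x :* t) :+ con (+ 2) :* a :+ con (+ 2) :* (x :* b)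
         := s :+ con (+ 2) :* a :+ con (+ 2) :* (x :* (t :+ b))) refl x _ _ _ _ ⟩
  squareSum (x ↑ 4) (suc N) ⊞ const (+ 2) ∙ (x ∙ triangleSum (x ↑ 8) (suc N)) ∎
  where open ≈-Reasoning

Triangles-S : ∀ x n → Triangles.S x n ≈ triangleSum x (n ℕ.* 2)
Triangles-S x zero    = refl
Triangles-S x (suc n) = R.+-cong (R.+-cong (Triangles-S x n)
  (trans (↑-assoc x (suc (n ℕ.* 2)) (suc n)) (R.reflexive (cong (x ↑_) (odd n)))))
  (trans (↑-assoc x (suc (suc n ℕ.* 2)) (suc n)) (R.reflexive (cong (x ↑_) (even n))))
  where
  odd : ∀ n → suc (n ℕ.* 2) ℕ.* suc n ≡ triangle (suc (n ℕ.* 2))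
  odd n = ℕ.*-cancelʳ-≡ _ _ 2 (≡.trans (ring n) (≡.sym (triangle-double (suc (n ℕ.* 2)))))
    where
    ring : ∀ n → suc (n ℕ.* 2) ℕ.* suc n ℕ.* 2 ≡ suc (n ℕ.* 2) ℕ.* suc (suc (n ℕ.* 2))
    ring = ℕSolver.solve-∀
  even : ∀ n → suc (suc n ℕ.* 2) ℕ.* suc n ≡ triangle (suc n ℕ.* 2)
  even n = ℕ.*-cancelʳ-≡ _ _ 2 (≡.trans (ring n) (≡.sym (triangle-double (suc n ℕ.* 2))))
    where
    ring : ∀ n → suc (suc n ℕ.* 2) ℕ.* suc n ℕ.* 2 ≡ suc n ℕ.* 2 ℕ.* suc (suc n ℕ.* 2)
    ring = ℕSolver.solve-∀

↑-1 : ∀ n → const 1ℤ ↑ n ≈ const 1ℤ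
↑-1 zero    = refl
↑-1 (suc n) = trans (R.*-identityˡ _) (↑-1 n)

-- The sign is (−1)^(n(n+1)) = 1.
signed-square : ∀ x n → (⊟ ((⊟ x) ↑ n)) ↑ n ≈ x ↑ (n ℕ.* n)
signed-square x n = begin
  (⊟ ((⊟ x) ↑ n)) ↑ n
    ≈⟨ ↑-cong n (R.-‿cong (trans (↑-cong n (solve 1 (λ x → :- x
         := con -1ℤ :* x) refl x)) (∙-↑ (const -1ℤ) x n))) ⟩
  (⊟ (const -1ℤ ↑ n ∙ x ↑ n)) ↑ n
    ≈⟨ ↑-cong n (solve 2 (λ s z → :- (s :* z) := con -1ℤ :* s :* z) refl (const -1ℤ ↑ n) (x ↑ n)) ⟩
  (const -1ℤ ↑ suc n ∙ x ↑ n) ↑ n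
    ≈⟨ ∙-↑ _ _ n ⟩
  (const -1ℤ ↑ suc n) ↑ n ∙ (x ↑ n) ↑ n
    ≈⟨ R.*-cong sign≈1 (↑-assoc x n n) ⟩
  const 1ℤ ∙ x ↑ (n ℕ.* n)
    ≈⟨ R.*-identityˡ _ ⟩
  x ↑ (n ℕ.* n) ∎
  where
  open ≈-Reasoning
  -1ℤ = ℤ.- 1ℤ
  sign≈1 : (const -1ℤ ↑ suc n) ↑ n ≈ const 1ℤ
  sign≈1 = trans (↑-assoc (const -1ℤ) (suc n) n) (trans
    (R.reflexive (cong (const -1ℤ ↑_) (≡.trans (ℕ.*-comm (suc n) n)
      (≡.trans (≡.sym (triangle-double n)) (ℕ.*-comm (triangle n) 2)))))
    (trans (sym (↑-assoc (const -1ℤ) 2 (triangle n)))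
      (trans (↑-cong (triangle n) (solve 0 (con -1ℤ :^ 2 := con 1ℤ) refl)) (↑-1 (triangle n)))))

Squares-S : ∀ x n → Squares.S (⊟ x) n ≈ squareSum x n
Squares-S x zero    = refl
Squares-S x (suc n) = R.+-cong (Squares-S x n) (R.*-congˡ (signed-square x (suc n)))

-- Gauss's theta functions

Unit : PowerSeries → Set
Unit f = f 0 ≡ 1ℤ

unit-∙ : ∀ {f g} → Unit f → Unit g → Unit (f ∙ g)
unit-∙ {f} {g} f0 g0 = ≡.trans (∙-zero f g) (cong₂ ℤ._*_ f0 g0)

unit-↑ : ∀ {f} n → Unit f → Unit (f ↑ n)
unit-↑ zero    f0 = ≡.refl
unit-↑ (suc n) f0 = unit-∙ f0 (unit-↑ n f0)

X↑-zero : ∀ r → (X ↑ suc r) 0 ≡ 0ℤ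
X↑-zero r = X∙-zero (X ↑ r)

dil : ℕ → PowerSeries → PowerSeries
dil r = ev (X ↑ r)

ev-X↑ : ∀ {y} → y 0 ≡ 0ℤ → ∀ n → ev y (X ↑ n) ≈ y ↑ n
ev-X↑ y0 n = trans (ev-↑ y0 X n) (↑-cong n (ev-X y0))

dil-dil : ∀ r s f → dil (suc r) (dil (suc s) f) ≈ dil (suc r ℕ.* suc s) f
dil-dil r s f = trans (ev-ev (X↑-zero r) (X↑-zero s) f)
  (ev-congˡ f (trans (ev-X↑ (X↑-zero r) (suc s)) (↑-assoc X (suc r) (suc s))))

-- U is a left inverse of the dilation q ↦ q⁴.
dil₄-injective : ∀ {f g} → dil 4 f ≈ dil 4 g → f ≈ g
dil₄-injective {f} {g} p = trans (sym (U-dil f)) (trans (U-cong p) (U-dil g))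
  where
  U-dil : ∀ f → U (dil 4 f) ≈ f
  U-dil f = trans (U-cong (sym (R.*-identityʳ _))) (trans (U-ev f (const 1ℤ))
    (trans (R.*-congˡ (mk λ { zero → ≡.refl ; (suc n) → ≡.refl })) (R.*-identityʳ f)))

dil₂-injective : ∀ {f g} → dil 2 f ≈ dil 2 g → f ≈ g
dil₂-injective {f} {g} p = dil₄-injective (trans (sym (dil-dil 1 1 f)) (trans (ev-cong _ p) (dil-dil 1 1 g)))

-X : PowerSeries
-X = ⊟ X

-X-zero : -X 0 ≡ 0ℤ
-X-zero = ⊟-at X 0

ev-neg-dil₂ : ∀ f → ev -X (dil 2 f) ≈ dil 2 f
ev-neg-dil₂ f = trans (ev-ev -X-zero (X↑-zero 1) f) (ev-congˡ f
  (trans (ev-X↑ -X-zero 2) (solve 1 (λ x → (:- x) :^ 2 := x :^ 2) refl X)))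

-- φ₋ is φ(−q), introduced through Gauss's product φ(−q) = E₁²/E₂ = E₂O².
E O Ō φ₋ φ ψ : PowerSeries
E = ∏^∞ (eulerFactor X)
O = ∏^∞ (oddFactor X)
Ō = ev -X O
φ₋ = dil 2 E ∙ O ↑ 2
φ = ev -X φ₋
ψ = dil 2 E ∙ inv O

E-below : ∀ N → E ≈[ suc N ] ∏ (eulerFactor X) N
E-below = ∏^∞-below λ i → 1-small (X↑-below (suc i))

O-below : ∀ N → O ≈[ suc N ] ∏ (oddFactor X) N
O-below = ∏^∞-below λ i → 1-small (weaken (s≤s (ℕ.m≤m*n i 2)) (X↑-below (suc (i ℕ.* 2))))

dil₂E-below : ∀ N → dil 2 E ≈[ suc N ] ∏ (eulerFactor (X ↑ 2)) N
dil₂E-below N = T.trans (ev-below (X ↑ 2) (E-below N)) (truncate (ev-euler (X↑-zero 1) N))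

O-unit : Unit O
O-unit = ≡.refl

dil₂E-unit : Unit (dil 2 E)
dil₂E-unit = ev-zero (X↑-zero 1) E

E≈ : E ≈ dil 2 E ∙ O
E≈ = limit λ N → weaken (ℕ.n≤1+n N) (T.trans (weaken (s≤s (ℕ.m≤m*n N 2)) (E-below (N ℕ.* 2)))
  (T.trans (truncate (euler-split X N)) (T.sym (∙-below (dil₂E-below N) (O-below N)))))

OŌ≈ : O ∙ Ō ≈ dil 2 O
OŌ≈ = limit λ N → weaken (ℕ.n≤1+n N) (T.trans
  (∙-below (O-below N) (T.trans (ev-below -X (O-below N)) (truncate (ev-odd -X-zero N))))
  (T.trans (truncate (odd-conjugate X N))
    (T.sym (T.trans (ev-below (X ↑ 2) (O-below N)) (truncate (ev-odd (X↑-zero 1) N))))))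

φ≈ : φ ≈ dil 2 E ∙ Ō ↑ 2
φ≈ = trans (ev-∙ -X-zero _ _) (R.*-cong (ev-neg-dil₂ E) (ev-↑ -X-zero O 2))

Oψ≈ : O ∙ ψ ≈ dil 2 E
Oψ≈ = trans (solve 3 (λ o e i → o :* (e :* i) := o :* i :* e) refl O (dil 2 E) (inv O))
  (trans (R.*-congʳ (inv-inverse {O} O-unit)) (R.*-identityˡ _))

φ₋-unit : Unit φ₋
φ₋-unit = unit-∙ dil₂E-unit (unit-↑ {O} 2 O-unit)

φ-unit : Unit φ
φ-unit = ≡.trans (ev-zero -X-zero φ₋) φ₋-unit

-- Modulo q^(N+1), E₂ is `B N`·`A N`. So E₂ times the sum is `A N`·`Y`, congruent to `A N`² and
-- hence to E² = E₂·φ₋; then E₂ is cancelled.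
φ₋-below : ∀ N → φ₋ ≈[ suc N ] Squares.S X N
φ₋-below N = T.sym (∙-cancel-below dil₂E-unit (begin
  dil 2 E ∙ S N
    ≈⟨ ∙-below (dil₂E-below N) T.refl ⟩
  ∏ (eulerFactor (X ↑ 2)) N ∙ S N
    ≈⟨ truncate (trans (R.*-congʳ (sym (euler-plus X N)))
         (solve 3 (λ b a s → b :* a :* s := a :* (b :* s)) refl (B N) (A N) (S N))) ⟩
  A N ∙ (B N ∙ S N)
    ≈⟨ truncate (R.*-congˡ (Y≈B∙S N)) ⟨
  A N ∙ Y (X ↑ suc N) N
    ≈⟨ ∙-below T.refl (Y-below (X↑-below (suc N)) N) ⟩
  A N ∙ A N
    ≈⟨ ∙-below (E-below N) (E-below N) ⟨
  E ∙ E
    ≈⟨ truncate (trans (R.*-cong E≈ E≈) (solve 2 (λ e o → e :* o :* (e :* o)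
         := e :* (e :* o :^ 2)) refl (dil 2 E) O)) ⟩
  dil 2 E ∙ φ₋ ∎))
  where
  open Squares X
  open T-Reasoning (suc N)

-- The same with O in place of E₂: O times the sum is `Y`, congruent to the product for E₂ = O·ψ.
ψ-below : ∀ N → ψ ≈[ suc N ] triangleSum X (N ℕ.* 2)
ψ-below N = T.sym (∙-cancel-below {f = O} O-unit (begin
  O ∙ triangleSum X (N ℕ.* 2)
    ≈⟨ ∙-below (O-below N) (truncate (sym (Triangles-S X N))) ⟩
  B N ∙ S N
    ≈⟨ truncate (Y≈B∙S N) ⟨
  Y (X ↑ suc (N ℕ.* 2)) N
    ≈⟨ Y-below (weaken (s≤s (ℕ.m≤m*n N 2)) (X↑-below (suc (N ℕ.* 2)))) N ⟩
  A N
    ≈⟨ dil₂E-below N ⟨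
  dil 2 E
    ≈⟨ truncate Oψ≈ ⟨
  O ∙ ψ ∎))
  where
  open Triangles X
  open T-Reasoning (suc N)

module _ {y : PowerSeries} (y0 : y 0 ≡ 0ℤ) where

  ev-S : ∀ n → ev y (Squares.S X n) ≈ Squares.S y n
  ev-S zero    = ev-const y0 1ℤ
  ev-S (suc n) = trans (ev-⊞ y0 _ _) (R.+-cong (ev-S n) (trans (ev-scale y0 (+ 2) _)
    (R.*-congˡ (trans (ev-↑ y0 _ (suc n)) (↑-cong (suc n) (trans (ev-⊟ y0 _) (R.-‿cong (ev-X↑ y0 (suc n)))))))))

  ev-squareSum : ∀ n → ev y (squareSum X n) ≈ squareSum y n
  ev-squareSum zero    = ev-const y0 1ℤ
  ev-squareSum (suc n) = trans (ev-⊞ y0 _ _) (R.+-cong (ev-squareSum n) (trans (ev-scale y0 (+ 2) _)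
    (R.*-congˡ (ev-X↑ y0 (suc n ℕ.* suc n)))))

  ev-triangleSum : ∀ n → ev y (triangleSum X n) ≈ triangleSum y n
  ev-triangleSum zero    = ev-const y0 1ℤ
  ev-triangleSum (suc n) = trans (ev-⊞ y0 _ _) (R.+-cong (ev-triangleSum n) (ev-X↑ y0 (triangle (suc n))))

φ-below : ∀ N → φ ≈[ suc N ] squareSum X N
φ-below N = T.trans (ev-below -X (φ₋-below N)) (truncate (trans (ev-S -X-zero N) (Squares-S X N)))

φ-split : φ ≈ dil 4 φ ⊞ const (+ 2) ∙ (X ∙ dil 8 ψ)
φ-split = limit λ N → weaken (ℕ.n≤1+n N) (go N)
  where
  go : ∀ N → φ ≈[ suc N ] dil 4 φ ⊞ const (+ 2) ∙ (X ∙ dil 8 ψ)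
  go N = begin
    φ
      -- The cutoff 4N + 1 is the one that `squareSum-split` needs to produce 2N triangular terms,
      -- the number supplied by `ψ-below N`.
      ≈⟨ weaken (ℕ.≤-trans (s≤s N≤N*2) (ℕ.≤-trans (s≤s (ℕ.m≤m*n (N ℕ.* 2) 2)) (ℕ.n≤1+n _)))
           (φ-below (suc (N ℕ.* 2 ℕ.* 2))) ⟩
    squareSum X (suc (N ℕ.* 2 ℕ.* 2))
      ≈⟨ truncate (squareSum-split X (N ℕ.* 2)) ⟩
    squareSum (X ↑ 4) (N ℕ.* 2) ⊞ const (+ 2) ∙ (X ∙ triangleSum (X ↑ 8) (N ℕ.* 2))
      ≈⟨ ⊞-below
           (T.trans (weaken (s≤s N≤N*2) (ev-below (X ↑ 4) (φ-below (N ℕ.* 2))))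
             (truncate (ev-squareSum (X↑-zero 3) (N ℕ.* 2))))
           (∙-below T.refl (∙-below (T.refl {x = X}) (T.trans (ev-below (X ↑ 8) (ψ-below N))
             (truncate (ev-triangleSum (X↑-zero 7) (N ℕ.* 2)))))) ⟨
    dil 4 φ ⊞ const (+ 2) ∙ (X ∙ dil 8 ψ) ∎
    where
    open T-Reasoning (suc N)
    N≤N*2 = ℕ.m≤m*n N 2

φ₋-split : φ₋ ≈ dil 4 φ - const (+ 2) ∙ (X ∙ dil 8 ψ)
φ₋-split = begin
  φ₋
    ≈⟨ trans (ev-ev -X-zero -X-zero φ₋) (trans (ev-congˡ φ₋ neg-neg-X) (ev-id φ₋)) ⟨
  ev -X φ
    ≈⟨ ev-cong -X φ-split ⟩
  ev -X (dil 4 φ ⊞ const (+ 2) ∙ (X ∙ dil 8 ψ))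
    ≈⟨ trans (ev-⊞ -X-zero _ _) (R.+-cong (even φ 1) (trans (ev-scale -X-zero (+ 2) _) (R.*-congˡ
         (trans (ev-∙ -X-zero _ _) (R.*-cong (ev-X -X-zero) (even ψ 3)))))) ⟩
  dil 4 φ ⊞ const (+ 2) ∙ (-X ∙ dil 8 ψ)
    ≈⟨ solve 3 (λ a x b → a :+ con (+ 2) :* ((:- x) :* b) := a :- con (+ 2) :* (x :* b)) refl _ X _ ⟩
  dil 4 φ - const (+ 2) ∙ (X ∙ dil 8 ψ) ∎
  where
  open ≈-Reasoning
  neg-neg-X : ev -X -X ≈ X
  neg-neg-X = trans (ev-⊟ -X-zero X) (trans (R.-‿cong (ev-X -X-zero)) (solve 1 (λ x → :- (:- x) := x) refl X))
  ev-id : ∀ f → ev X f ≈ f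
  ev-id f = limit λ N → go N f
    where
    go : ∀ N f → ev X f ≈[ N ] f
    go zero    f = mk λ ()
    go (suc N) f = T.trans (truncate (ev-unfold ≡.refl f)) (T.trans
      (⊞-below T.refl (∙-raise ≡.refl (go N (tail f)))) (truncate (sym (unfold-X f))))
  even : ∀ f r → ev -X (dil (2 ℕ.* suc r) f) ≈ dil (2 ℕ.* suc r) f
  even f r = trans (ev-cong -X (sym (dil-dil 1 r f))) (trans (ev-neg-dil₂ (dil (suc r) f)) (dil-dil 1 r f))

-- Product and quadratic identities between the theta functions

dil₂E≈ : dil 2 E ≈ dil 4 E ∙ dil 2 O
dil₂E≈ = trans (ev-cong _ E≈) (trans (ev-∙ (X↑-zero 1) _ _) (R.*-congʳ (dil-dil 1 1 E)))

dil₄E≈ : dil 4 E ≈ dil 8 E ∙ dil 4 O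
dil₄E≈ = trans (ev-cong _ E≈) (trans (ev-∙ (X↑-zero 3) _ _) (R.*-congʳ (dil-dil 3 1 E)))

φφ₋≈ : φ ∙ φ₋ ≈ (dil 2 E ∙ dil 2 O) ↑ 2
φφ₋≈ = begin
  φ ∙ φ₋
    ≈⟨ R.*-congʳ φ≈ ⟩
  dil 2 E ∙ Ō ↑ 2 ∙ (dil 2 E ∙ O ↑ 2)
    ≈⟨ solve 3 (λ e p o → e :* p :^ 2 :* (e :* o :^ 2) := (e :* (o :* p)) :^ 2) refl (dil 2 E) Ō O ⟩
  (dil 2 E ∙ (O ∙ Ō)) ↑ 2
    ≈⟨ ↑-cong 2 (R.*-congˡ OŌ≈) ⟩
  (dil 2 E ∙ dil 2 O) ↑ 2 ∎
  where open ≈-Reasoning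

-- The multiplier O(q)²O(q²) clears the inverses in ψ(q) and ψ(q²); what remains follows from
-- O(q)O(-q) = O(q²) and E₂ = E₄·O(q²).
dil₂ψφ≈ : dil 2 ψ ∙ φ ≈ ψ ↑ 2
dil₂ψφ≈ = ∙-cancel (unit-∙ (unit-↑ {O} 2 O-unit) (≡.trans (ev-zero (X↑-zero 1) O) O-unit)) (begin
  O ↑ 2 ∙ dil 2 O ∙ (dil 2 ψ ∙ φ)
    ≈⟨ R.*-congˡ (R.*-congˡ φ≈) ⟩
  O ↑ 2 ∙ dil 2 O ∙ (dil 2 ψ ∙ (dil 2 E ∙ Ō ↑ 2))
    ≈⟨ solve 5 (λ o o₂ s e p → o :^ 2 :* o₂ :* (s :* (e :* p :^ 2))
         := o₂ :* s :* e :* (o :* p) :^ 2) refl O (dil 2 O) (dil 2 ψ) (dil 2 E) Ō ⟩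
  dil 2 O ∙ dil 2 ψ ∙ dil 2 E ∙ (O ∙ Ō) ↑ 2
    ≈⟨ R.*-cong (R.*-congʳ O₂ψ₂≈) (↑-cong 2 OŌ≈) ⟩
  dil 4 E ∙ dil 2 E ∙ dil 2 O ↑ 2
    ≈⟨ solve 3 (λ e₄ e₂ o₂ → e₄ :* e₂ :* o₂ :^ 2 := e₄ :* o₂ :* e₂ :* o₂) refl (dil 4 E) (dil 2 E) (dil 2 O) ⟩
  dil 4 E ∙ dil 2 O ∙ dil 2 E ∙ dil 2 O
    ≈⟨ R.*-congʳ (R.*-cong (trans (sym dil₂E≈) (sym Oψ≈)) (sym Oψ≈)) ⟩
  O ∙ ψ ∙ (O ∙ ψ) ∙ dil 2 O
    ≈⟨ solve 3 (λ o s o₂ → o :* s :* (o :* s) :* o₂ := o :^ 2 :* o₂ :* s :^ 2) refl O ψ (dil 2 O) ⟩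
  O ↑ 2 ∙ dil 2 O ∙ ψ ↑ 2 ∎)
  where
  open ≈-Reasoning
  O₂ψ₂≈ : dil 2 O ∙ dil 2 ψ ≈ dil 4 E
  O₂ψ₂≈ = trans (sym (ev-∙ (X↑-zero 1) O ψ)) (trans (ev-cong _ Oψ≈) (dil-dil 1 1 E))

dil₈ψ∙dil₄φ≈ : dil 8 ψ ∙ dil 4 φ ≈ dil 4 ψ ↑ 2
dil₈ψ∙dil₄φ≈ = begin
  dil 8 ψ ∙ dil 4 φ          ≈⟨ R.*-congʳ (dil-dil 3 1 ψ) ⟨
  dil 4 (dil 2 ψ) ∙ dil 4 φ  ≈⟨ ev-∙ (X↑-zero 3) _ _ ⟨
  dil 4 (dil 2 ψ ∙ φ)        ≈⟨ ev-cong _ dil₂ψφ≈ ⟩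
  dil 4 (ψ ↑ 2)              ≈⟨ ev-↑ (X↑-zero 3) ψ 2 ⟩
  dil 4 ψ ↑ 2                ∎
  where open ≈-Reasoning

-- φ(q)φ(−q) = φ(−q²)², split into powers of q, is an identity in q².
φ₋²≈ : φ₋ ↑ 2 ≈ dil 2 φ ↑ 2 - const (+ 4) ∙ (X ∙ dil 4 ψ ↑ 2)
φ₋²≈ = dil₂-injective (begin
  dil 2 (φ₋ ↑ 2)
    ≈⟨ trans (ev-↑ (X↑-zero 1) φ₋ 2) (↑-cong 2 (trans (ev-∙ (X↑-zero 1) _ _)
         (R.*-cong (dil-dil 1 1 E) (ev-↑ (X↑-zero 1) O 2)))) ⟩
  (dil 4 E ∙ dil 2 O ↑ 2) ↑ 2
    ≈⟨ ↑-cong 2 (trans (solve 2 (λ e o → e :* o :^ 2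
         := e :* o :* o) refl (dil 4 E) (dil 2 O)) (R.*-congʳ (sym dil₂E≈))) ⟩
  (dil 2 E ∙ dil 2 O) ↑ 2
    ≈⟨ φφ₋≈ ⟨
  φ ∙ φ₋
    ≈⟨ R.*-cong φ-split φ₋-split ⟩
  (dil 4 φ ⊞ const (+ 2) ∙ (X ∙ dil 8 ψ)) ∙ (dil 4 φ - const (+ 2) ∙ (X ∙ dil 8 ψ))
    ≈⟨ solve 3 (λ a x b → (a :+ con (+ 2) :* (x :* b)) :* (a :- con (+ 2) :* (x :* b))
         := a :^ 2 :- con (+ 4) :* (x :^ 2 :* b :^ 2)) refl (dil 4 φ) X (dil 8 ψ) ⟩
  dil 4 φ ↑ 2 - const (+ 4) ∙ (X ↑ 2 ∙ dil 8 ψ ↑ 2)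
    ≈⟨ R.+-cong
         (trans (ev-↑ (X↑-zero 1) (dil 2 φ) 2) (↑-cong 2 (dil-dil 1 1 φ)))
         (trans (ev-⊟ (X↑-zero 1) _) (R.-‿cong (trans (ev-scale (X↑-zero 1) (+ 4) _) (R.*-congˡ
           (trans (ev-∙ (X↑-zero 1) X _) (R.*-cong (ev-X (X↑-zero 1))
             (trans (ev-↑ (X↑-zero 1) (dil 4 ψ) 2) (↑-cong 2 (dil-dil 1 3 ψ))))))))) ⟨
  dil 2 (dil 2 φ ↑ 2) ⊞ dil 2 (⊟ (const (+ 4) ∙ (X ∙ dil 4 ψ ↑ 2)))
    ≈⟨ ev-⊞ (X↑-zero 1) _ _ ⟨
  dil 2 (dil 2 φ ↑ 2 - const (+ 4) ∙ (X ∙ dil 4 ψ ↑ 2)) ∎)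
  where open ≈-Reasoning

-- Two expressions for φ₋² are compared, `φ₋²≈` and the square of `φ₋-split`. The cross term
-- -4qψ(q⁸)φ(q⁴) of the square is -4qψ(q⁴)² and cancels.
dil₂φ²≈ : dil 2 φ ↑ 2 ≈ dil 4 φ ↑ 2 ⊞ const (+ 4) ∙ (X ∙ dil 8 ψ) ↑ 2
dil₂φ²≈ = begin
  dil 2 φ ↑ 2
    ≈⟨ solve 2 (λ s t → s := s :- t :+ t) refl (dil 2 φ ↑ 2) t ⟩
  dil 2 φ ↑ 2 - t ⊞ t
    ≈⟨ R.+-cong (trans (sym φ₋²≈) (↑-cong 2 φ₋-split)) (R.*-congˡ (R.*-congˡ (sym dil₈ψ∙dil₄φ≈))) ⟩
  (dil 4 φ - const (+ 2) ∙ (X ∙ dil 8 ψ)) ↑ 2 ⊞ const (+ 4) ∙ (X ∙ (dil 8 ψ ∙ dil 4 φ))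
    ≈⟨ solve 3 (λ a x b → (a :- con (+ 2) :* (x :* b)) :^ 2 :+ con (+ 4) :* (x :* (b :* a))
         := a :^ 2 :+ con (+ 4) :* (x :* b) :^ 2) refl (dil 4 φ) X (dil 8 ψ) ⟩
  dil 4 φ ↑ 2 ⊞ const (+ 4) ∙ (X ∙ dil 8 ψ) ↑ 2 ∎
  where
  open ≈-Reasoning
  t = const (+ 4) ∙ (X ∙ dil 4 ψ ↑ 2)

-- The series of d₇

D A P Z e k g₀ w v W : PowerSeries
D = d 7
A = dil 2 ψ ∙ inv φ
P = φ ↑ 11 ∙ dil 2 E ↑ 4
Z = inv P
e = X ∙ (const 1ℤ ⊞ X ↑ 2) ∙ inv ((const 1ℤ ⊞ X) ↑ 4)
k = inv ((const 1ℤ - X) ∙ (const 1ℤ ⊞ X) ↑ 12)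
g₀ = (const 1ℤ ⊞ X) ↑ 11 ∙ inv ((const 1ℤ - X) ↑ 11)
w = upper A
v = const (+ 2) ∙ w
W = lower A

opaque
  unfolding _∙_ _⊞_
  -- Found by evaluation. By hand: ke = x(1 + x²)/((1 - x)(1 + x)¹⁶), where 1/((1 - x)(1 + x)¹⁶) = 1
  -- - 15x + 121x² + ..., so the coefficient is 121 + 1.
  ke₃ : (k ∙ e) 3 ≡ + 122
  ke₃ = ≡.refl

P-unit : Unit P
P-unit = unit-∙ (unit-↑ 11 φ-unit) (unit-↑ 4 dil₂E-unit)

v-zero : v 0 ≡ 0ℤ
v-zero = ≡.trans (const-∙ (+ 2) w 0) (cong (+ 2 ℤ.*_) (X∙-zero (dil 4 A)))

opaque
  unfolding _⊞_ ⊟_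
  unit-⊞ : ∀ {f g} → Unit f → g 0 ≡ 0ℤ → Unit (f ⊞ g)
  unit-⊞ f0 g0 = cong₂ ℤ._+_ f0 g0
  unit-- : ∀ {f g} → Unit f → g 0 ≡ 0ℤ → Unit (f - g)
  unit-- f0 g0 = cong₂ (λ a b → a ℤ.+ ℤ.- b) f0 g0

1+X-unit : Unit (const 1ℤ ⊞ X)
1+X-unit = unit-⊞ {const 1ℤ} {X} ≡.refl ≡.refl

1-X-unit : Unit (const 1ℤ - X)
1-X-unit = unit-- {const 1ℤ} {X} ≡.refl ≡.refl

1+v-unit : Unit (const 1ℤ ⊞ v)
1+v-unit = unit-⊞ {const 1ℤ} ≡.refl v-zero

1-v-unit : Unit (const 1ℤ - v)
1-v-unit = unit-- {const 1ℤ} ≡.refl v-zero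

dil₄φ-unit : Unit (dil 4 φ)
dil₄φ-unit = ≡.trans (ev-zero X⁴-zero φ) φ-unit

ev-inv : ∀ {y f} → y 0 ≡ 0ℤ → Unit f → ev y f ∙ ev y (inv f) ≈ const 1ℤ
ev-inv {y} {f} y0 f0 = trans (sym (ev-∙ y0 f (inv f))) (trans (ev-cong y (inv-inverse f0)) (ev-const y0 1ℤ))

ev-1+X : ∀ {y} → y 0 ≡ 0ℤ → ev y (const 1ℤ ⊞ X) ≈ const 1ℤ ⊞ y
ev-1+X y0 = trans (ev-⊞ y0 _ _) (R.+-cong (ev-const y0 1ℤ) (ev-X y0))

ev-1-X : ∀ {y} → y 0 ≡ 0ℤ → ev y (const 1ℤ - X) ≈ const 1ℤ - y
ev-1-X y0 = trans (ev-⊞ y0 _ _) (R.+-cong (ev-const y0 1ℤ) (trans (ev-⊟ y0 X) (R.-‿cong (ev-X y0))))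

Aφ≈ : A ∙ φ ≈ dil 2 ψ
Aφ≈ = trans (solve 3 (λ s i f → s :* i :* f := f :* i :* s) refl (dil 2 ψ) (inv φ) φ)
  (trans (R.*-congʳ (inv-inverse φ-unit)) (R.*-identityˡ _))

w∙dil₄φ≈ : w ∙ dil 4 φ ≈ X ∙ dil 8 ψ
w∙dil₄φ≈ = trans (R.*-assoc X _ _) (R.*-congˡ
  (trans (sym (ev-∙ X⁴-zero A φ)) (trans (ev-cong _ Aφ≈) (dil-dil 3 1 ψ))))

[1+v]dil₄φ≈ : (const 1ℤ ⊞ v) ∙ dil 4 φ ≈ φ
[1+v]dil₄φ≈ = trans (solve 2 (λ w a → (con 1ℤ :+ con (+ 2) :* w) :* a
     := a :+ con (+ 2) :* (w :* a)) refl w (dil 4 φ))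
  (trans (R.+-congˡ (R.*-congˡ w∙dil₄φ≈)) (sym φ-split))

[1-v]dil₄φ≈ : (const 1ℤ - v) ∙ dil 4 φ ≈ φ₋
[1-v]dil₄φ≈ = trans (solve 2 (λ w a → (con 1ℤ :- con (+ 2) :* w) :* a
     := a :- con (+ 2) :* (w :* a)) refl w (dil 4 φ))
  (trans (R.+-congˡ (R.-‿cong (R.*-congˡ w∙dil₄φ≈))) (sym φ₋-split))

-- A modular equation between q and q⁴. Times φ(q⁴)⁴, the left side is qψ(q²)⁴ = q(ψ(q⁴)φ(q²))²; by
-- `dil₈ψ∙dil₄φ≈` and `dil₂φ²≈` this is a polynomial in φ(q⁴) and qψ(q⁸) = wφ(q⁴).
W[1+v]⁴≈ : W ∙ (const 1ℤ ⊞ v) ↑ 4 ≈ w ∙ (const 1ℤ ⊞ v ↑ 2)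
W[1+v]⁴≈ = ∙-cancel (unit-↑ 4 dil₄φ-unit) (begin
  a ↑ 4 ∙ (W ∙ (const 1ℤ ⊞ v) ↑ 4)
    ≈⟨ solve 3 (λ a W u → a :^ 4 :* (W :* u :^ 4) := W :* (u :* a) :^ 4) refl a W (const 1ℤ ⊞ v) ⟩
  W ∙ ((const 1ℤ ⊞ v) ∙ a) ↑ 4
    ≈⟨ R.*-congˡ (↑-cong 4 [1+v]dil₄φ≈) ⟩
  X ∙ A ↑ 4 ∙ φ ↑ 4
    ≈⟨ solve 3 (λ x A f → x :* A :^ 4 :* f :^ 4 := x :* (A :* f) :^ 4) refl X A φ ⟩
  X ∙ (A ∙ φ) ↑ 4
    ≈⟨ R.*-congˡ (↑-cong 4 Aφ≈) ⟩
  X ∙ dil 2 ψ ↑ 4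
    ≈⟨ solve 2 (λ x s → x :* s :^ 4 := x :* (s :^ 2) :^ 2) refl X (dil 2 ψ) ⟩
  X ∙ (dil 2 ψ ↑ 2) ↑ 2
    ≈⟨ R.*-congˡ (↑-cong 2 ψ₂²≈) ⟩
  X ∙ (dil 4 ψ ∙ dil 2 φ) ↑ 2
    ≈⟨ solve 3 (λ x s f → x :* (s :* f) :^ 2 := x :* s :^ 2 :* f :^ 2) refl X (dil 4 ψ) (dil 2 φ) ⟩
  X ∙ dil 4 ψ ↑ 2 ∙ dil 2 φ ↑ 2
    ≈⟨ R.*-cong (R.*-congˡ (sym dil₈ψ∙dil₄φ≈)) dil₂φ²≈ ⟩
  X ∙ (dil 8 ψ ∙ a) ∙ (a ↑ 2 ⊞ const (+ 4) ∙ (X ∙ dil 8 ψ) ↑ 2)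
    ≈⟨ solve 3 (λ x s a → x :* (s :* a) :* (a :^ 2 :+ con (+ 4) :* (x :* s) :^ 2)
         := (x :* s) :* a :* (a :^ 2 :+ con (+ 4) :* (x :* s) :^ 2)) refl X (dil 8 ψ) a ⟩
  (X ∙ dil 8 ψ) ∙ a ∙ (a ↑ 2 ⊞ const (+ 4) ∙ (X ∙ dil 8 ψ) ↑ 2)
    ≈⟨ R.*-cong (R.*-congʳ w∙dil₄φ≈) (R.+-congˡ (R.*-congˡ (↑-cong 2 w∙dil₄φ≈))) ⟨
  (w ∙ a) ∙ a ∙ (a ↑ 2 ⊞ const (+ 4) ∙ (w ∙ a) ↑ 2)
    ≈⟨ solve 2 (λ w a → (w :* a) :* a :* (a :^ 2 :+ con (+ 4) :* (w :* a) :^ 2)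
         := a :^ 4 :* (w :* (con 1ℤ :+ (con (+ 2) :* w) :^ 2))) refl w a ⟩
  a ↑ 4 ∙ (w ∙ (const 1ℤ ⊞ v ↑ 2)) ∎)
  where
  open ≈-Reasoning
  a = dil 4 φ
  ψ₂²≈ : dil 2 ψ ↑ 2 ≈ dil 4 ψ ∙ dil 2 φ
  ψ₂²≈ = trans (sym (ev-↑ (X↑-zero 1) ψ 2)) (trans (ev-cong _ (sym dil₂ψφ≈))
    (trans (ev-∙ (X↑-zero 1) _ _) (R.*-congʳ (dil-dil 1 1 ψ))))

-- Doubling turns the factor w of `W[1+v]⁴≈` into v, which is what gives e integer coefficients.
2W≈ev : const (+ 2) ∙ W ≈ ev v e
2W≈ev = ∙-cancel (unit-↑ 4 1+v-unit) (begin
  u ↑ 4 ∙ (const (+ 2) ∙ W)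
    ≈⟨ solve 2 (λ u W → u :^ 4 :* (con (+ 2) :* W) := con (+ 2) :* (W :* u :^ 4)) refl u W ⟩
  const (+ 2) ∙ (W ∙ u ↑ 4)
    ≈⟨ R.*-congˡ W[1+v]⁴≈ ⟩
  const (+ 2) ∙ (w ∙ (const 1ℤ ⊞ v ↑ 2))
    ≈⟨ trans (sym (R.*-assoc _ w _)) (sym (R.*-identityʳ _)) ⟩
  v ∙ (const 1ℤ ⊞ v ↑ 2) ∙ const 1ℤ
    ≈⟨ R.*-cong
         (R.*-cong (ev-X v-zero) (trans (ev-⊞ v-zero _ _) (R.+-cong (ev-const v-zero 1ℤ) (ev-X↑ v-zero 2))))
         (ev-inv v-zero (unit-↑ 4 1+X-unit)) ⟨
  ev v X ∙ ev v (const 1ℤ ⊞ X ↑ 2) ∙ (ev v ((const 1ℤ ⊞ X) ↑ 4) ∙ ev v (inv ((const 1ℤ ⊞ X) ↑ 4)))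
    ≈⟨ solve 4 (λ a b c d → a :* b :* (c :* d) := c :* (a :* b :* d)) refl _ _ _ _ ⟩
  ev v ((const 1ℤ ⊞ X) ↑ 4) ∙ (ev v X ∙ ev v (const 1ℤ ⊞ X ↑ 2) ∙ ev v (inv ((const 1ℤ ⊞ X) ↑ 4)))
    ≈⟨ R.*-cong (trans (ev-↑ v-zero _ 4) (↑-cong 4 (ev-1+X v-zero)))
         (trans (R.*-congʳ (sym (ev-∙ v-zero _ _))) (sym (ev-∙ v-zero _ _))) ⟩
  u ↑ 4 ∙ ev v e ∎)
  where
  open ≈-Reasoning
  u = const 1ℤ ⊞ v

-- Origin of the exponents of k: replacing φ¹¹ by φ(q⁴)¹¹ costs (1 + v)¹¹, and E₈⁴/E₂⁴ =
-- ψ(q⁸)φ(q⁴)/(φφ₋) brings one more 1 + v and the single 1 - v.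
X∙Z≈ : X ∙ Z ≈ dil 4 Z ∙ (w ∙ ev v k)
X∙Z≈ = ∙-cancel (unit-∙ (unit-∙ P-unit P₄-unit) K-unit) (begin
  P ∙ P₄ ∙ K ∙ (X ∙ Z)
    ≈⟨ solve 5 (λ p p₄ K x z → p :* p₄ :* K :* (x :* z) := x :* p₄ :* K :* (p :* z)) refl P P₄ K X Z ⟩
  X ∙ P₄ ∙ K ∙ (P ∙ Z)
    ≈⟨ R.*-congˡ (inv-inverse P-unit) ⟩
  X ∙ P₄ ∙ K ∙ const 1ℤ
    ≈⟨ R.*-congʳ core ⟩
  P ∙ w ∙ const 1ℤ
    ≈⟨ solve 1 (λ y → y :* con 1ℤ := con 1ℤ :* con 1ℤ :* y) refl (P ∙ w) ⟩
  const 1ℤ ∙ const 1ℤ ∙ (P ∙ w)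
    ≈⟨ R.*-congʳ (R.*-cong (ev-inv X⁴-zero P-unit)
         (trans (R.*-congʳ (sym ev-K)) (ev-inv v-zero (unit-∙ 1-X-unit (unit-↑ 12 1+X-unit))))) ⟨
  P₄ ∙ dil 4 Z ∙ (K ∙ ev v k) ∙ (P ∙ w)
    ≈⟨ solve 6 (λ p₄ z₄ K k p w → p₄ :* z₄ :* (K :* k) :* (p :* w)
         := p :* p₄ :* K :* (z₄ :* (w :* k))) refl P₄ (dil 4 Z) K (ev v k) P w ⟩
  P ∙ P₄ ∙ K ∙ (dil 4 Z ∙ (w ∙ ev v k)) ∎)
  where
  open ≈-Reasoning
  P₄ = dil 4 P
  K = (const 1ℤ - v) ∙ (const 1ℤ ⊞ v) ↑ 12
  a = dil 4 φ
  e₂ = dil 2 E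
  e₈ = dil 8 E
  P₄-unit : Unit P₄
  P₄-unit = ≡.trans (ev-zero X⁴-zero P) P-unit
  K-unit : Unit K
  K-unit = unit-∙ 1-v-unit (unit-↑ 12 1+v-unit)
  ev-K : ev v ((const 1ℤ - X) ∙ (const 1ℤ ⊞ X) ↑ 12) ≈ K
  ev-K = trans (ev-∙ v-zero _ _) (R.*-cong (ev-1-X v-zero) (trans (ev-↑ v-zero _ 12) (↑-cong 12 (ev-1+X v-zero))))
  P₄≈ : P₄ ≈ a ↑ 11 ∙ e₈ ↑ 4
  P₄≈ = trans (ev-∙ X⁴-zero _ _) (R.*-cong (ev-↑ X⁴-zero φ 11)
    (trans (ev-↑ X⁴-zero _ 4) (↑-cong 4 (dil-dil 3 1 E))))
  -- Times O(q⁴)², both sides become products: E₂ = E₈·O(q⁴)·O(q²) and E₈ = O(q⁴)ψ(q⁴).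
  e₈⁴φφ₋≈ : e₈ ↑ 4 ∙ (φ ∙ φ₋) ≈ e₂ ↑ 4 ∙ (dil 8 ψ ∙ a)
  e₈⁴φφ₋≈ = ∙-cancel (unit-↑ 2 O₄-unit) (begin
    o₄ ↑ 2 ∙ (e₈ ↑ 4 ∙ (φ ∙ φ₋))
      ≈⟨ R.*-congˡ (R.*-congˡ φφ₋≈) ⟩
    o₄ ↑ 2 ∙ (e₈ ↑ 4 ∙ (e₂ ∙ o₂) ↑ 2)
      ≈⟨ solve 4 (λ o₄ e₈ e₂ o₂ → o₄ :^ 2 :* (e₈ :^ 4 :* (e₂ :* o₂) :^ 2)
           := (e₈ :* o₄ :* o₂) :^ 2 :* e₂ :^ 2 :* e₈ :^ 2) refl o₄ e₈ e₂ o₂ ⟩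
    (e₈ ∙ o₄ ∙ o₂) ↑ 2 ∙ e₂ ↑ 2 ∙ e₈ ↑ 2
      ≈⟨ R.*-cong (R.*-congʳ (↑-cong 2 (trans (R.*-congʳ (sym dil₄E≈)) (sym dil₂E≈)))) (↑-cong 2 (sym O₄ψ₄≈)) ⟩
    e₂ ↑ 2 ∙ e₂ ↑ 2 ∙ (o₄ ∙ dil 4 ψ) ↑ 2
      ≈⟨ solve 3 (λ e₂ o₄ s → e₂ :^ 2 :* e₂ :^ 2 :* (o₄ :* s) :^ 2
           := o₄ :^ 2 :* (e₂ :^ 4 :* s :^ 2)) refl e₂ o₄ (dil 4 ψ) ⟩
    o₄ ↑ 2 ∙ (e₂ ↑ 4 ∙ dil 4 ψ ↑ 2)
      ≈⟨ R.*-congˡ (R.*-congˡ dil₈ψ∙dil₄φ≈) ⟨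
    o₄ ↑ 2 ∙ (e₂ ↑ 4 ∙ (dil 8 ψ ∙ a)) ∎)
    where
    o₂ = dil 2 O
    o₄ = dil 4 O
    O₄-unit : Unit o₄
    O₄-unit = ≡.trans (ev-zero X⁴-zero O) O-unit
    O₄ψ₄≈ : o₄ ∙ dil 4 ψ ≈ e₈
    O₄ψ₄≈ = trans (sym (ev-∙ X⁴-zero O ψ)) (trans (ev-cong _ Oψ≈) (dil-dil 3 1 E))
  core : X ∙ P₄ ∙ K ≈ P ∙ w
  core = ∙-cancel (unit-↑ 2 dil₄φ-unit) (begin
    a ↑ 2 ∙ (X ∙ P₄ ∙ K)
      ≈⟨ R.*-congˡ (R.*-congʳ (R.*-congˡ P₄≈)) ⟩
    a ↑ 2 ∙ (X ∙ (a ↑ 11 ∙ e₈ ↑ 4) ∙ ((const 1ℤ - v) ∙ (const 1ℤ ⊞ v) ↑ 12))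
      ≈⟨ solve 5 (λ a x e₈ m p → a :^ 2 :* (x :* (a :^ 11 :* e₈ :^ 4) :* (m :* p :^ 12))
           := x :* e₈ :^ 4 :* (m :* a) :* (p :* a) :^ 12) refl a X e₈ (const 1ℤ - v) (const 1ℤ ⊞ v) ⟩
    X ∙ e₈ ↑ 4 ∙ ((const 1ℤ - v) ∙ a) ∙ ((const 1ℤ ⊞ v) ∙ a) ↑ 12
      ≈⟨ R.*-cong (R.*-congˡ [1-v]dil₄φ≈) (↑-cong 12 [1+v]dil₄φ≈) ⟩
    X ∙ e₈ ↑ 4 ∙ φ₋ ∙ φ ↑ 12
      ≈⟨ solve 4 (λ x e₈ m f → x :* e₈ :^ 4 :* m :* f :^ 12
           := x :* f :^ 11 :* (e₈ :^ 4 :* (f :* m))) refl X e₈ φ₋ φ ⟩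
    X ∙ φ ↑ 11 ∙ (e₈ ↑ 4 ∙ (φ ∙ φ₋))
      ≈⟨ R.*-congˡ e₈⁴φφ₋≈ ⟩
    X ∙ φ ↑ 11 ∙ (e₂ ↑ 4 ∙ (dil 8 ψ ∙ a))
      ≈⟨ solve 5 (λ x f e₂ s a → x :* f :^ 11 :* (e₂ :^ 4 :* (s :* a))
           := f :^ 11 :* e₂ :^ 4 :* (x :* s) :* a) refl X φ e₂ (dil 8 ψ) a ⟩
    φ ↑ 11 ∙ e₂ ↑ 4 ∙ (X ∙ dil 8 ψ) ∙ a
      ≈⟨ R.*-congʳ (R.*-congˡ w∙dil₄φ≈) ⟨
    P ∙ (w ∙ a) ∙ a
      ≈⟨ solve 3 (λ p w a → p :* (w :* a) :* a := a :^ 2 :* (p :* w)) refl P w a ⟩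
    a ↑ 2 ∙ (P ∙ w) ∎)

^ₛ≈↑ : ∀ f n → f ^ₛ n ≈ f ↑ n
^ₛ≈↑ f zero    = 1ₛ≈1
^ₛ≈↑ f (suc n) = trans (⊛≈∙ f (f ^ₛ n)) (R.*-congˡ (^ₛ≈↑ f n))

1-q^≈1-X↑ : ∀ m → 1-q^ m ≈ const 1ℤ - X ↑ m
1-q^≈1-X↑ m = trans (1-q^≈ m) (R.+-congˡ (R.-‿cong (q^≈X↑ m)))

∏[1⋯]≈∏ : ∀ F N → ∏[1⋯ N ] F ≈ ∏ (λ i → F (suc i)) N
∏[1⋯]≈∏ F zero    = 1ₛ≈1
∏[1⋯]≈∏ F (suc N) = trans (⊛≈∙ (F (suc N)) (∏[1⋯ N ] F)) (R.*-congˡ (∏[1⋯]≈∏ F N))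

factor≈ : ∀ k m → factor k m ≈ (const 1ℤ - X ↑ (2 ℕ.* m)) ↑ k ∙ (1/1-q^ m) ↑ (3 ℕ.* k ℕ.+ 1)
factor≈ k m = trans (⊛≈∙ ((1-q^ (2 ℕ.* m)) ^ₛ k) ((1/1-q^ m) ^ₛ (3 ℕ.* k ℕ.+ 1)))
  (R.*-cong (trans (^ₛ≈↑ (1-q^ (2 ℕ.* m)) k) (↑-cong k (1-q^≈1-X↑ (2 ℕ.* m)))) (^ₛ≈↑ (1/1-q^ m) (3 ℕ.* k ℕ.+ 1)))

euler-inverse : ∀ i → eulerFactor X i ∙ (1/1-q^ suc i) ≈ const 1ℤ
euler-inverse i = trans (R.*-congʳ (sym (1-q^≈1-X↑ (suc i)))) (trans (sym (⊛≈∙ (1-q^ suc i) (1/1-q^ suc i)))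
  (trans (mk (1-q^-inverse (suc i))) 1ₛ≈1))

cancel-↑ : ∀ {p g} n a → p ∙ g ≈ const 1ℤ → a ∙ g ↑ n ∙ p ↑ n ≈ a
cancel-↑ {p} {g} n a pg≈1 = begin
  a ∙ g ↑ n ∙ p ↑ n    ≈⟨ solve 3 (λ a g p → a :* g :* p := a :* (p :* g)) refl a (g ↑ n) (p ↑ n) ⟩
  a ∙ (p ↑ n ∙ g ↑ n)  ≈⟨ R.*-congˡ (trans (sym (∙-↑ p g n)) (trans (↑-cong n pg≈1) (↑-1 n))) ⟩
  a ∙ const 1ℤ         ≈⟨ R.*-identityʳ a ⟩
  a                    ∎
  where open ≈-Reasoning

factor∙euler : ∀ k i → factor k (suc i) ∙ eulerFactor X i ↑ (3 ℕ.* k ℕ.+ 1) ≈ eulerFactor (X ↑ 2) i ↑ k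
factor∙euler k i = trans (R.*-congʳ (factor≈ k (suc i)))
  (trans (cancel-↑ (3 ℕ.* k ℕ.+ 1) _ (euler-inverse i))
    (↑-cong k (R.+-congˡ (R.-‿cong (sym (↑-assoc X 2 (suc i)))))))

-- The generating function cleared of its denominator, with 22 = 3·7 + 1. `d-generating-function`
-- lets the same N factors serve all coefficients up to q^N.
D∙E²²≈ : D ∙ E ↑ 22 ≈ dil 2 E ↑ 7
D∙E²²≈ = limit λ N → weaken (ℕ.n≤1+n N) (go N)
  where
  ↑-below : ∀ {N f g} n → f ≈[ N ] g → f ↑ n ≈[ N ] g ↑ n
  ↑-below zero    p = T.refl
  ↑-below (suc n) p = ∙-below p (↑-below n p)
  go : ∀ N → D ∙ E ↑ 22 ≈[ suc N ] dil 2 E ↑ 7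
  go N = begin
    D ∙ E ↑ 22
      ≈⟨ ∙-below (mk λ { (s≤s n≤N) → ≡.sym (d-generating-function 7 n≤N) }) (↑-below 22 (E-below N)) ⟩
    ∏[1⋯ N ] (factor 7) ∙ ∏ (eulerFactor X) N ↑ 22
      ≈⟨ truncate (R.*-cong (∏[1⋯]≈∏ (factor 7) N) (sym (∏-↑ (eulerFactor X) 22 N))) ⟩
    ∏ (λ i → factor 7 (suc i)) N ∙ ∏ (λ i → eulerFactor X i ↑ 22) N
      ≈⟨ truncate (trans (sym (∏-∙ _ _ N)) (trans (∏-cong (factor∙euler 7) N) (∏-↑ _ 7 N))) ⟩
    ∏ (eulerFactor (X ↑ 2)) N ↑ 7
      ≈⟨ ↑-below 7 (dil₂E-below N) ⟨
    dil 2 E ↑ 7 ∎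
    where open T-Reasoning (suc N)

-- As E² = E₂φ₋, the power E²² is E₂¹¹φ₋¹¹; this is where the exponents 11 and 4 = 11 - 7 of `P`
-- come from. Trading φ₋¹¹ for φ¹¹ then costs (φ/φ₋)¹¹ = g₀(v).
D≈ : D ≈ Z ∙ ev v g₀
D≈ = ∙-cancel (unit-∙ (unit-∙ P-unit M-unit) (unit-∙ (unit-↑ 11 dil₄φ-unit) (unit-↑ 7 dil₂E-unit))) (begin
  P ∙ M ∙ (a ↑ 11 ∙ e₂ ↑ 7) ∙ D
    ≈⟨ solve 5 (λ f e₂ m a d → f :^ 11 :* e₂ :^ 4 :* m :^ 11 :* (a :^ 11 :* e₂ :^ 7) :* d
         := f :^ 11 :* (d :* (e₂ :* (m :* a)) :^ 11)) refl φ e₂ (const 1ℤ - v) a D ⟩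
  φ ↑ 11 ∙ (D ∙ (e₂ ∙ ((const 1ℤ - v) ∙ a)) ↑ 11)
    ≈⟨ R.*-congˡ (R.*-congˡ (↑-cong 11 (trans (R.*-congˡ [1-v]dil₄φ≈) (trans
         (solve 2 (λ e o → e :* (e :* o :^ 2) := (e :* o) :^ 2) refl e₂ O) (↑-cong 2 (sym E≈)))))) ⟩
  φ ↑ 11 ∙ (D ∙ (E ↑ 2) ↑ 11)
    ≈⟨ R.*-congˡ (trans (R.*-congˡ (↑-assoc E 2 11)) D∙E²²≈) ⟩
  φ ↑ 11 ∙ e₂ ↑ 7
    ≈⟨ R.*-congʳ (↑-cong 11 [1+v]dil₄φ≈) ⟨
  ((const 1ℤ ⊞ v) ∙ a) ↑ 11 ∙ e₂ ↑ 7
    ≈⟨ solve 3 (λ p a e₂ → (p :* a) :^ 11 :* e₂ :^ 7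
         := con 1ℤ :* con 1ℤ :* (a :^ 11 :* e₂ :^ 7) :* p :^ 11) refl (const 1ℤ ⊞ v) a e₂ ⟩
  const 1ℤ ∙ const 1ℤ ∙ (a ↑ 11 ∙ e₂ ↑ 7) ∙ (const 1ℤ ⊞ v) ↑ 11
    ≈⟨ R.*-cong (R.*-congʳ (R.*-cong (inv-inverse P-unit)
         (trans (R.*-congʳ (sym ev-M)) (ev-inv v-zero (unit-↑ 11 1-X-unit)))))
         (trans (ev-↑ v-zero _ 11) (↑-cong 11 (ev-1+X v-zero))) ⟨
  P ∙ Z ∙ (M ∙ i) ∙ (a ↑ 11 ∙ e₂ ↑ 7) ∙ ev v ((const 1ℤ ⊞ X) ↑ 11)
    ≈⟨ solve 6 (λ p z m i t n → p :* z :* (m :* i) :* t :* n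
         := p :* m :* t :* (z :* (n :* i))) refl P Z M i (a ↑ 11 ∙ e₂ ↑ 7) _ ⟩
  P ∙ M ∙ (a ↑ 11 ∙ e₂ ↑ 7) ∙ (Z ∙ (ev v ((const 1ℤ ⊞ X) ↑ 11) ∙ i))
    ≈⟨ R.*-congˡ (R.*-congˡ (ev-∙ v-zero _ _)) ⟨
  P ∙ M ∙ (a ↑ 11 ∙ e₂ ↑ 7) ∙ (Z ∙ ev v g₀) ∎)
  where
  open ≈-Reasoning
  M = (const 1ℤ - v) ↑ 11
  a = dil 4 φ
  e₂ = dil 2 E
  i = ev v (inv ((const 1ℤ - X) ↑ 11))
  M-unit : Unit M
  M-unit = unit-↑ 11 1-v-unit
  ev-M : ev v ((const 1ℤ - X) ↑ 11) ≈ M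
  ev-M = trans (ev-↑ v-zero _ 11) (↑-cong 11 (ev-1-X v-zero))

e-zero : e 0 ≡ 0ℤ
e-zero = ≡.trans (∙-zero _ (inv ((const 1ℤ ⊞ X) ↑ 4)))
  (cong (ℤ._* inv ((const 1ℤ ⊞ X) ↑ 4) 0) (X∙-zero (const 1ℤ ⊞ X ↑ 2)))

open Descent A Z k e e-zero 2W≈ev X∙Z≈ (+ 61) ke₃
  using (Divisible; Divisible-resp; Divisible-start; Divisible-step; Divisible⇒∣)

-- Iterating the step, and the residue class of n

steps : ℕ → PowerSeries → PowerSeries
steps zero    f = f
steps (suc α) f = steps α (step f)

Divisible-steps : ∀ {m f} α → Divisible m f → Divisible (m ℤ.* + (8 ℕ.^ α)) (steps α f)
Divisible-steps {m} {f} zero p = ≡.subst (λ m → Divisible m f) (≡.sym (ℤ.*-identityʳ m)) p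
Divisible-steps {m} {f} (suc α) p = ≡.subst (λ m → Divisible m (steps (suc α) f))
  (≡.trans (ℤ.*-assoc m (+ 8) _) (cong (m ℤ.*_) (≡.sym (ℤ.pos-* 8 (8 ℕ.^ α)))))
  (Divisible-steps α (Divisible-step p))

8^∣steps : ∀ α n → + (8 ℕ.^ suc α) ∣ steps (suc α) D n
8^∣steps α n = ≡.subst (_∣ steps (suc α) D n) eq
  -- The factor 4 comes from the first step, 8^α from the other α steps, and the final 2 from
  -- `Divisible⇒∣`.
  (Divisible⇒∣ {m = + 4 ℤ.* + (8 ℕ.^ α)} (Divisible-steps α start) n)
  where
  start : Divisible (+ 4) (step D)
  start = Divisible-resp {m = + 4} (step-cong (sym D≈)) (Divisible-start g₀)
  ring : ∀ x → + 4 ℤ.* x ℤ.* + 2 ≡ + 8 ℤ.* x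
  ring = ℤSolver.solve-∀
  eq : + 4 ℤ.* + (8 ℕ.^ α) ℤ.* + 2 ≡ + (8 ℕ.^ suc α)
  eq = ≡.trans (ring (+ (8 ℕ.^ α))) (≡.sym (ℤ.pos-* 8 (8 ℕ.^ α)))

-- For n = r + 4t, subtracting 4·3t from 3n - 1 leaves 3r - 1, one of -1, 2, 5, 8; only 8 is a
-- multiple of 4.
4∣3n-1 : ∀ n → + 4 ∣ + 3 ℤ.* + n ℤ.- + 1 → ∃ λ t → n ≡ 3 ℕ.+ t ℕ.* 4
4∣3n-1 n 4∣ with n divMod 4
... | result t r n≡ = go r n≡
  where
  ring : ∀ r t → + 3 ℤ.* (r ℤ.+ t ℤ.* + 4) ℤ.- + 1 ℤ.- + 4 ℤ.* (+ 3 ℤ.* t) ≡ + 3 ℤ.* r ℤ.- + 1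
  ring = ℤSolver.solve-∀
  reduce : ∀ r → n ≡ r ℕ.+ t ℕ.* 4 → + 4 ∣ + 3 ℤ.* + r ℤ.- + 1
  reduce r n≡ = ≡.subst (+ 4 ∣_)
    (≡.trans (cong (λ m → + 3 ℤ.* m ℤ.- + 1 ℤ.- + 4 ℤ.* (+ 3 ℤ.* + t))
      (≡.trans (cong +_ n≡) (cong (λ m → + r ℤ.+ m) (ℤ.pos-* t 4)))) (ring (+ r) (+ t)))
    (∣m∣n⇒∣m-n 4∣ (∣m⇒∣m*n (+ 3 ℤ.* + t) ∣-refl))
  go : ∀ r → n ≡ toℕ r ℕ.+ t ℕ.* 4 → ∃ λ t → n ≡ 3 ℕ.+ t ℕ.* 4
  go Fin.zero                               n≡ = contradiction (reduce 0 n≡) (from-no (+ 4 ∣? + 3 ℤ.* + 0 ℤ.- + 1))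
  go (Fin.suc Fin.zero)                     n≡ = contradiction (reduce 1 n≡) (from-no (+ 4 ∣? + 3 ℤ.* + 1 ℤ.- + 1))
  go (Fin.suc (Fin.suc Fin.zero))           n≡ = contradiction (reduce 2 n≡) (from-no (+ 4 ∣? + 3 ℤ.* + 2 ℤ.- + 1))
  go (Fin.suc (Fin.suc (Fin.suc Fin.zero))) n≡ = t , n≡

3[4t+3]-1 : ∀ t → + 3 ℤ.* + (3 ℕ.+ t ℕ.* 4) ℤ.- + 1 ≡ + 4 ℤ.* (+ 3 ℤ.* + suc t ℤ.- + 1)
3[4t+3]-1 t = ≡.trans (cong (λ m → + 3 ℤ.* (+ 3 ℤ.+ m) ℤ.- + 1) (ℤ.pos-* t 4)) (ring (+ t))
  where
  ring : ∀ t → + 3 ℤ.* (+ 3 ℤ.+ t ℤ.* + 4) ℤ.- + 1 ≡ + 4 ℤ.* (+ 3 ℤ.* (+ 1 ℤ.+ t) ℤ.- + 1)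
  ring = ℤSolver.solve-∀

quarter : ∀ α t → + (4 ℕ.^ suc α) ∣ + 3 ℤ.* + (3 ℕ.+ t ℕ.* 4) ℤ.- + 1 → + (4 ℕ.^ α) ∣ + 3 ℤ.* + suc t ℤ.- + 1
quarter α t p = *-cancelˡ-∣ (+ 4) {+ (4 ℕ.^ α)} {+ 3 ℤ.* + suc t ℤ.- + 1}
  (≡.subst₂ _∣_ (ℤ.pos-* 4 (4 ℕ.^ α)) (3[4t+3]-1 t) p)

-- The condition on n reproduces itself: 3(4t + 3) - 1 = 4(3(t + 1) - 1), and coefficient 4t + 3 of
-- f is coefficient t + 1 of its step, so α drops by one.
coefficient-steps : ∀ α f n → + (4 ℕ.^ α) ∣ + 3 ℤ.* + n ℤ.- + 1 → ∃ λ m → f n ≡ steps α f m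
coefficient-steps zero    f n _ = n , ≡.refl
coefficient-steps (suc α) f n p = go (4∣3n-1 n (∣-trans 4∣4^ p))
  where
  4∣4^ : + 4 ∣ + (4 ℕ.^ suc α)
  4∣4^ = ≡.subst (+ 4 ∣_) (≡.sym (ℤ.pos-* 4 (4 ℕ.^ α))) (∣m⇒∣m*n (+ (4 ℕ.^ α)) ∣-refl)
  go : ∃ (λ t → n ≡ 3 ℕ.+ t ℕ.* 4) → ∃ λ m → f n ≡ steps (suc α) f m
  go (t , n≡) = map₂ (λ eq → ≡.trans (cong f n≡) (≡.trans (≡.sym (X∙-suc f (3 ℕ.+ t ℕ.* 4))) eq))
    (coefficient-steps α (step f) (suc t)
      (quarter α t (≡.subst (λ n → + (4 ℕ.^ suc α) ∣ + 3 ℤ.* + n ℤ.- + 1) n≡ p)))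

theorem1p1 : (n α : ℕ) → n ≥ 1 → α ≥ 1 →
    (+ 3) * (+ n) ≡ + 1 [mod + (4 ^ α) ] →
    d 7 n ≡ + 0 [mod + (8 ^ α) ]
theorem1p1 n (suc α) _ _ p = conclude (coefficient-steps (suc α) D n p)
  where
  conclude : ∃ (λ m → d 7 n ≡ steps (suc α) D m) → d 7 n ≡ + 0 [mod + (8 ^ suc α) ]
  conclude (m , eq) = ≡.subst (+ (8 ℕ.^ suc α) ∣_) (≡.sym (≡.trans (ℤ.+-identityʳ (d 7 n)) eq)) (8^∣steps α m)
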